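{- Let $\ell\ge1$ be fixed and let $G$ be a graph on $n$ vertices together with a grid representation $\mathcal{R}=(\mathcal{G},\mathcal{P},x)$ such that each path in $\mathcal{P}$ has horizontal part of length at most $\ell$ and a constant number of bends. One can compute, in $O(n\log n)$ time, a tree decomposition $\mathcal{T}=(T,\{X_t\}_{t\in V(T)})$ and a layering $(V_1,V_2,\ldots)$ of $G$ such that $|V(T)|=O(n)$ and, for every bag $X_t$ and layer $V_i$: $\alpha(G[X_t\cap V_i])\le2\ell$ if $x=v$, and $\alpha(G[X_t\cap V_i])\le6\ell-1$ if $x=e$. In particular, $G$ has layered tree-independence number at most $2\ell$ if $x=v$ and at most $6\ell-1$ if $x=e$.
   Context: A grid representation of $G$ is a triple $(\mathcal{G},\mathcal{P},x)$ where $\mathcal{G}$ is a rectangular grid (integer grid lines), $\mathcal{P}=\{P_u\}_{u\in V(G)}$ is a collection of paths on the grid (polygonal curves along grid lines between grid-points) in bijection with $V(G)$, and $x\in\{v,e\}$; if $x=v$ (VPG), distinct $u,w$ are adjacent iff $P_u$ and $P_w$ share a grid-point; if $x=e$ (EPG), iff they share a grid-edge. A bend is a $90$-degree turn of a path at a grid-point. The horizontal part of a path is its projection onto the $x$-axis (an interval). Each path is encoded by its endpoints and bend-points in order. $\alpha$ denotes independence number. A tree decomposition of $G$ is a pair $(T,\{X_t\})$ with $T$ a tree and bags $X_t\subseteq V(G)$ such that every vertex lies in some bag, every edge has both ends in some bag, and for each vertex the nodes whose bags contain it induce a connected subtree. A layering of $G$ is a partition $(V_1,V_2,\ldots)$ of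 $V(G)$ such that every edge joins vertices in the same or consecutive layers. The layered tree-independence number is the minimum over tree decompositions and layerings of $\max_{t,i}\alpha(G[X_t\cap V_i])$. -}

module Defs where

open import Data.Nat as ℕ using (ℕ; zero; suc; _≤_; _≥_; _∸_; NonZero)
open import Data.Integer as ℤ using (ℤ; +_)
open import Data.Integer.DivMod using (_/ℕ_)
open import Data.Fin using (Fin; toℕ)
open import Data.Fin.Properties using (all?)
open import Data.Fin.Subset using (Subset; inside; outside; _∈_; _⊆_; _∩_; ∣_∣)
open import Data.Fin.Subset.Properties using (_∈?_; _⊆?_)
open import Data.List as List using (List; []; _∷_; _++_; length)
open import Data.List.Extrema.Nat using (max)
open import Data.List.Membership.Propositional using () renaming (_∈_ to _∈ₗ_)
open import Data.List.NonEmpty as List⁺ using (List⁺; toList)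
open import Data.List.Relation.Unary.All using (All)
open import Data.List.Relation.Unary.Any using (Any)
open import Data.List.Relation.Unary.Linked using (Linked)
open import Data.List.Relation.Unary.Unique.Propositional using (Unique)
open import Data.Product using (Σ; ∃; ∃₂; _×_; _,_; proj₁; proj₂)
open import Data.Sum using (_⊎_)
open import Data.Vec as Vec using (Vec; []; _∷_)
open import Function using (_⇔_)
open import Relation.Binary.Construct.Closure.ReflexiveTransitive using (Star)
open import Relation.Binary.PropositionalEquality using (_≡_; _≢_)
open import Relation.Nullary using (¬_; Dec)
open import Relation.Nullary.Decidable using (⌊_⌋; _×-dec_; _→-dec_; ¬?)

_∈O_ : (ℕ → ℕ) → (ℕ → ℕ) → Set
f ∈O g = ∃₂ λ c n₀ → ∀ n → n ≥ n₀ → f n ≤ c ℕ.* g n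

record Graph (n : ℕ) : Set₁ where
  field
    Adj    : Fin n → Fin n → Set
    adj?   : ∀ u w → Dec (Adj u w)
    sym    : ∀ {u w} → Adj u w → Adj w u
    irrefl : ∀ {u} → ¬ Adj u u

open Graph public using (Adj; adj?)

IndependentIn : ∀ {n} → Graph n → Subset n → Subset n → Set
IndependentIn G S I = I ⊆ S × (∀ u w → u ∈ I → w ∈ I → ¬ Adj G u w)

independentIn? : ∀ {n} (G : Graph n) (S I : Subset n) → Dec (IndependentIn G S I)
independentIn? G S I =
  (I ⊆? S) ×-dec
  all? (λ u → all? (λ w → (u ∈? I) →-dec ((w ∈? I) →-dec ¬? (adj? G u w))))

subsets : ∀ n → List (Subset n)
subsets zero    = [] ∷ []
subsets (suc n) = List.map (outside ∷_) (subsets n) ++ List.map (inside ∷_) (subsets n)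

-- α G S is the independence number of the induced subgraph G[S]; the
-- independent sets of G[S] are those of G contained in S.
α : ∀ {n} → Graph n → Subset n → ℕ
α {n} G S = max 0 (List.map ∣_∣ (List.filter (independentIn? G S) (subsets n)))

Cycle : ∀ {m} → Graph m → Set
Cycle G = ∃₂ λ v vs →
  2 ≤ length vs × Unique (v ∷ vs) × Linked (Adj G) (v ∷ (vs ++ v ∷ []))

record IsTree {m : ℕ} (T : Graph m) : Set where
  field
    nonempty  : 1 ≤ m
    connected : ∀ s t → Star (Adj T) s t
    acyclic   : ¬ Cycle T

record TreeDecomposition {n : ℕ} (G : Graph n) : Set₁ where
  field
    nodes        : ℕ
    tree         : Graph nodes
    isTree       : IsTree tree
    bag          : Fin nodes → Subset n
    vertex-cover : ∀ v → ∃ λ t → v ∈ bag t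
    edge-cover   : ∀ u w → Adj G u w → ∃ λ t → u ∈ bag t × w ∈ bag t
    coherent     : ∀ v s t → v ∈ bag s → v ∈ bag t →
                   Star (λ a b → Adj tree a b × v ∈ bag a × v ∈ bag b) s t

open TreeDecomposition public using (nodes; tree; bag)

-- A partition into an indexed family of (possibly empty) layers is the map
-- sending each vertex to the index of its layer; indices start at 0.
-- As adjacency is symmetric, `close` bounds the difference both ways.
record Layering {n : ℕ} (G : Graph n) : Set where
  field
    layerOf : Fin n → ℕ
    close   : ∀ u w → Adj G u w → layerOf u ≤ suc (layerOf w)

  layer : ℕ → Subset n
  layer i = Vec.tabulate (λ v → ⌊ layerOf v ℕ.≟ i ⌋)

open Layering public using (layerOf; layer)

IsWidth : ∀ {n} {G : Graph n} → TreeDecomposition G → Layering G → ℕ → Set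
IsWidth {G = G} 𝒯 L w =
  (∃₂ λ t i → α G (bag 𝒯 t ∩ layer L i) ≡ w) ×
  (∀ t i → α G (bag 𝒯 t ∩ layer L i) ≤ w)

IsLayeredTreeIndependenceNumber : ∀ {n} → Graph n → ℕ → Set₁
IsLayeredTreeIndependenceNumber G m =
  (∃₂ λ (𝒯 : TreeDecomposition G) (L : Layering G) → IsWidth 𝒯 L m) ×
  (∀ (𝒯 : TreeDecomposition G) (L : Layering G) w → IsWidth 𝒯 L w → m ≤ w)

-- The double negation covers only the existence of the minimum, which holds
-- classically (a nonempty set of naturals has a least element).
LayeredTreeIndependenceNumber≤ : ∀ {n} → Graph n → ℕ → Set₁
LayeredTreeIndependenceNumber≤ G k =
  ¬ ¬ (∃ λ m → IsLayeredTreeIndependenceNumber G m × m ≤ k)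

Point : Set
Point = ℤ × ℤ

data Direction : Set where
  horizontal vertical : Direction

turn : Direction → Direction
turn horizontal = vertical
turn vertical   = horizontal

Segment : Direction → Point → Point → Set
Segment horizontal (x , y) (x′ , y′) = x ≢ x′ × y ≡ y′
Segment vertical   (x , y) (x′ , y′) = x ≡ x′ × y ≢ y′

-- Lists of the form: one endpoint, the bends in order, the other endpoint.
-- A one-element list is the path consisting of a single grid-point.
data Rectilinear : Direction → List Point → Set where
  stop : ∀ {d p} → Rectilinear d (p ∷ [])
  step : ∀ {d p q ps} → Segment d p q → Rectilinear (turn d) (q ∷ ps) →
         Rectilinear d (p ∷ q ∷ ps)

record GridPath : Set where
  field
    corners     : List⁺ Point
    rectilinear : ∃ λ d → Rectilinear d (toList corners)

open GridPath public using (corners)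

bends : GridPath → ℕ
bends P = length (toList (corners P)) ∸ 2

-- The projection of a path onto the x-axis is the interval spanned by the
-- abscissae of its endpoints and bends.
left right : GridPath → ℤ
left  P = List⁺.foldr₁ ℤ._⊓_ (List⁺.map proj₁ (corners P))
right P = List⁺.foldr₁ ℤ._⊔_ (List⁺.map proj₁ (corners P))

horizontalLength : GridPath → ℤ
horizontalLength P = right P ℤ.- left P

Between : ℤ → ℤ → ℤ → Set
Between a b c = (a ℤ.⊓ b) ℤ.≤ c × c ℤ.≤ (a ℤ.⊔ b)

-- For axis-aligned p and q their bounding box is the segment pq.
OnSegment : Point → Point → Point → Set
OnSegment (x , y) (x′ , y′) (a , b) = Between x x′ a × Between y y′ b

data PointOn (r : Point) : List Point → Set where
  corner : ∀ {ps} → PointOn r (r ∷ ps)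
  inner  : ∀ {p q ps} → OnSegment p q r → PointOn r (p ∷ q ∷ ps)
  later  : ∀ {p ps} → PointOn r ps → PointOn r (p ∷ ps)

-- A grid-edge is given by its left (or lower) end and its direction.
GridEdge : Set
GridEdge = Point × Direction

ends : GridEdge → Point × Point
ends ((x , y) , horizontal) = (x , y) , (ℤ.suc x , y)
ends ((x , y) , vertical)   = (x , y) , (x , ℤ.suc y)

data EdgeOn (e : GridEdge) : List Point → Set where
  inner : ∀ {p q ps} → OnSegment p q (proj₁ (ends e)) →
          OnSegment p q (proj₂ (ends e)) → EdgeOn e (p ∷ q ∷ ps)
  later : ∀ {p ps} → EdgeOn e ps → EdgeOn e (p ∷ ps)

data Mode : Set where
  vpg epg : Mode

Share : Mode → GridPath → GridPath → Set
Share vpg P Q = ∃ λ r → PointOn r (toList (corners P)) × PointOn r (toList (corners Q))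
Share epg P Q = ∃ λ e → EdgeOn e (toList (corners P)) × EdgeOn e (toList (corners Q))

record Grid : Set where
  field
    xmin xmax ymin ymax : ℤ

InGrid : Grid → Point → Set
InGrid 𝒢 (x , y) = (xmin ℤ.≤ x × x ℤ.≤ xmax) × (ymin ℤ.≤ y × y ℤ.≤ ymax)
  where open Grid 𝒢

record GridRepresentation {n : ℕ} (G : Graph n) : Set where
  field
    grid     : Grid
    path     : Fin n → GridPath
    mode     : Mode
    inGrid   : ∀ u → All (InGrid grid) (toList (corners (path u)))
    adjacent : ∀ u w → u ≢ w → Adj G u w ⇔ Share mode (path u) (path w)

open GridRepresentation public using (grid; path; mode)

-- Model of computation: a first-order call-by-value functional language
-- over integers and immutable cons cells, where every evaluation step has
-- unit cost. A program is a finite table of mutually recursive functions; as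
-- program, scopes and arities are fixed, a unit-cost RAM simulates a step in
-- constant time.

data Val : Set where
  int  : ℤ → Val
  nil  : Val
  cons : Val → Val → Val

data Exp {F : ℕ} (arity : Fin F → ℕ) (k : ℕ) : Set where
  var      : Fin k → Exp arity k
  lit      : ℤ → Exp arity k
  nil      : Exp arity k
  cons     : Exp arity k → Exp arity k → Exp arity k
  add sub  : Exp arity k → Exp arity k → Exp arity k
  div      : (c : ℕ) .{{_ : NonZero c}} → Exp arity k → Exp arity k
  ifLeq    : (a b yes no : Exp arity k) → Exp arity k
  caseList : Exp arity k → Exp arity k → Exp arity (2 ℕ.+ k) → Exp arity k
  bind     : Exp arity k → Exp arity (1 ℕ.+ k) → Exp arity k
  call     : (f : Fin F) → Vec (Exp arity k) (arity f) → Exp arity k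

record Program : Set where
  field
    functions : ℕ
    arity     : Fin functions → ℕ
    body      : ∀ f → Exp arity (arity f)
    main      : Exp arity 1

module Semantics (P : Program) where
  open Program P

  infix 4 _⊢_⇓_∣_ _⊢*_⇓_∣_

  mutual
    -- ρ ⊢ e ⇓ v ∣ c : in environment ρ, e evaluates to v at cost c.
    data _⊢_⇓_∣_ {k : ℕ} (ρ : Vec Val k) : Exp arity k → Val → ℕ → Set where
      var : ∀ i → ρ ⊢ var i ⇓ Vec.lookup ρ i ∣ 1
      lit : ∀ z → ρ ⊢ lit z ⇓ int z ∣ 1
      nil : ρ ⊢ nil ⇓ nil ∣ 1
      cons : ∀ {a b v w c d} →
        ρ ⊢ a ⇓ v ∣ c → ρ ⊢ b ⇓ w ∣ d →
        ρ ⊢ cons a b ⇓ cons v w ∣ suc (c ℕ.+ d)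
      add : ∀ {a b x y c d} →
        ρ ⊢ a ⇓ int x ∣ c → ρ ⊢ b ⇓ int y ∣ d →
        ρ ⊢ add a b ⇓ int (x ℤ.+ y) ∣ suc (c ℕ.+ d)
      sub : ∀ {a b x y c d} →
        ρ ⊢ a ⇓ int x ∣ c → ρ ⊢ b ⇓ int y ∣ d →
        ρ ⊢ sub a b ⇓ int (x ℤ.- y) ∣ suc (c ℕ.+ d)
      div : ∀ {q a x c} .{{_ : NonZero q}} →
        ρ ⊢ a ⇓ int x ∣ c →
        ρ ⊢ div q a ⇓ int (x /ℕ q) ∣ suc c
      if-yes : ∀ {a b s t x y v c d e} → x ℤ.≤ y →
        ρ ⊢ a ⇓ int x ∣ c → ρ ⊢ b ⇓ int y ∣ d → ρ ⊢ s ⇓ v ∣ e →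
        ρ ⊢ ifLeq a b s t ⇓ v ∣ suc (c ℕ.+ d ℕ.+ e)
      if-no : ∀ {a b s t x y v c d e} → y ℤ.< x →
        ρ ⊢ a ⇓ int x ∣ c → ρ ⊢ b ⇓ int y ∣ d → ρ ⊢ t ⇓ v ∣ e →
        ρ ⊢ ifLeq a b s t ⇓ v ∣ suc (c ℕ.+ d ℕ.+ e)
      case-nil : ∀ {a s t v c d} →
        ρ ⊢ a ⇓ nil ∣ c → ρ ⊢ s ⇓ v ∣ d →
        ρ ⊢ caseList a s t ⇓ v ∣ suc (c ℕ.+ d)
      case-cons : ∀ {a s t h r v c d} →
        ρ ⊢ a ⇓ cons h r ∣ c → (h ∷ r ∷ ρ) ⊢ t ⇓ v ∣ d →
        ρ ⊢ caseList a s t ⇓ v ∣ suc (c ℕ.+ d)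
      bind : ∀ {a b v w c d} →
        ρ ⊢ a ⇓ v ∣ c → (v ∷ ρ) ⊢ b ⇓ w ∣ d →
        ρ ⊢ bind a b ⇓ w ∣ suc (c ℕ.+ d)
      call : ∀ {f as vs w c d} →
        ρ ⊢* as ⇓ vs ∣ c → vs ⊢ body f ⇓ w ∣ d →
        ρ ⊢ call f as ⇓ w ∣ suc (c ℕ.+ d)

    data _⊢*_⇓_∣_ {k : ℕ} (ρ : Vec Val k) :
                  ∀ {a} → Vec (Exp arity k) a → Vec Val a → ℕ → Set where
      []  : ρ ⊢* [] ⇓ [] ∣ 0
      _∷_ : ∀ {a} {e : Exp arity k} {es : Vec (Exp arity k) a} {v vs c d} →
        ρ ⊢ e ⇓ v ∣ c → ρ ⊢* es ⇓ vs ∣ d →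
        ρ ⊢* (e ∷ es) ⇓ (v ∷ vs) ∣ (c ℕ.+ d)

Runs : Program → Val → Val → ℕ → Set
Runs P input output cost = (input ∷ []) ⊢ Program.main P ⇓ output ∣ cost
  where open Semantics P

encodeList : ∀ {a} {A : Set a} → (A → Val) → List A → Val
encodeList f []       = nil
encodeList f (x ∷ xs) = cons (f x) (encodeList f xs)

encodePair : ∀ {a} {A : Set a} → (A → Val) → A × A → Val
encodePair f (x , y) = cons (f x) (f y)

encodeℕ : ℕ → Val
encodeℕ n = int (+ n)

encodeFin : ∀ {n} → Fin n → Val
encodeFin i = encodeℕ (toℕ i)

encodeMode : Mode → Val
encodeMode vpg = encodeℕ 0
encodeMode epg = encodeℕ 1

encodeGrid : Grid → Val
encodeGrid 𝒢 = encodeList int (xmin ∷ xmax ∷ ymin ∷ ymax ∷ [])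
  where open Grid 𝒢

encodePath : GridPath → Val
encodePath P = encodeList (encodePair int) (toList (corners P))

encodeRepresentation : ∀ {n} {G : Graph n} → GridRepresentation G → Val
encodeRepresentation R =
  cons (encodeGrid (grid R))
  (cons (encodeList encodePath (List.tabulate (path R)))
        (encodeMode (mode R)))

-- The output lists the number of nodes, the edges of the tree, for each vertex
-- v the set of nodes whose bags contain v, and for each vertex its layer index.
-- Node sets are written as unions of intervals [a , b] of node numbers. Every
-- tree decomposition has such an encoding. Listing the bags element by element
-- is not an option: their total size can be forced to be quadratic in n.
record Encodes {n : ℕ} {G : Graph n} (output : Val)
               (𝒯 : TreeDecomposition G) (L : Layering G) : Set where
  field
    edges  : List (Fin (nodes 𝒯) × Fin (nodes 𝒯))
    runs   : Fin n → List (Fin (nodes 𝒯) × Fin (nodes 𝒯))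
    format : output ≡
      cons (encodeℕ (nodes 𝒯))
      (cons (encodeList (encodePair encodeFin) edges)
      (cons (encodeList (encodeList (encodePair encodeFin)) (List.tabulate runs))
            (encodeList encodeℕ (List.tabulate (layerOf L)))))
    edges⇔ : ∀ s t → Adj (tree 𝒯) s t ⇔ ((s , t) ∈ₗ edges ⊎ (t , s) ∈ₗ edges)
    runs⇔  : ∀ v t → v ∈ bag 𝒯 t ⇔
             Any (λ ab → toℕ (proj₁ ab) ≤ toℕ t × toℕ t ≤ toℕ (proj₂ ab)) (runs v)

bound : Mode → ℕ → ℕ
bound vpg ℓ = 2 ℕ.* ℓ
bound epg ℓ = 6 ℕ.* ℓ ∸ 1

{-# OPTIONS --safe #-}
module Submission where

-- Cut the plane into vertical slabs of ℓ columns and let the layer of a vertex be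
-- the slab containing the left end of its path; adjacent paths share a column, and
-- their left ends are at most ℓ apart, so edges join equal or consecutive layers.
-- The vertical projections of the paths are intervals, which give a path
-- decomposition whose bags consist of the paths meeting a horizontal line y. The
-- paths of one bag and one layer all meet y inside a window of 2ℓ columns, so
-- pairwise nonadjacent ones use distinct grid-points out of 2ℓ (if x = v), or
-- distinct grid-edges incident to these points, out of (2ℓ - 1) + 2ℓ + 2ℓ (if
-- x = e). In an EPG representation a path may be a single grid-point; its vertex is
-- isolated and gets a layer of its own.
--
-- Only the lowest ordinates b₁ ≤ … ≤ bₙ of the paths matter as values of y: a path
-- with vertical projection [b , t] lies in the bags numbered from 1 + rank (b - 1)
-- to rank t, where rank y = #{ j : bⱼ ≤ y }. The program sorts the bⱼ by bottom-up
-- merging, then joins them pairwise, again bottom-up, into a search tree of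
-- logarithmic depth that answers the 2n rank queries.

open import Defs
open import Data.Empty using (⊥)
open import Data.Fin as Fin using (Fin; zero; suc; toℕ; inject₁; fromℕ<; #_)
import Data.Fin.Properties as Fin
open import Data.Fin.Subset using (Subset; inside; outside; _∈_; _∩_; ∣_∣)
open import Data.Fin.Subset.Properties using (x∈p∩q⁻; nonempty?)
open import Data.Integer as ℤ using (ℤ; +_)
import Data.Integer.Properties as ℤ
open import Data.List as List using (List; []; _∷_; _++_; length; upTo)
open import Data.List.Extrema.Nat using (max≤v⁺)
open import Data.List.Membership.Propositional using () renaming (_∈_ to _∈ₗ_)
import Data.List.Membership.Propositional.Properties as Membership
open Membership using (∈-map⁺; ∈-upTo⁺; ∈-++⁺ˡ; ∈-++⁺ʳ)
open import Data.List.NonEmpty as List⁺ using (List⁺; _∷_; toList)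
import Data.List.Properties as List
open import Data.List.Relation.Binary.Permutation.Propositional using (_↭_; ↭-refl; ↭-trans; ↭-reflexive)
open import Data.List.Relation.Binary.Permutation.Propositional.Properties using (merge-↭; ++⁺; filter-↭; ↭-length)
open import Data.List.Relation.Binary.Pointwise using (Pointwise; []; _∷_)
open import Data.List.Relation.Unary.All as All using (All; []; _∷_)
import Data.List.Relation.Unary.All.Properties as All
open import Data.List.Relation.Unary.AllPairs using (AllPairs; []; _∷_)
open import Data.List.Relation.Unary.Any as Any using (here; there)
import Data.List.Relation.Unary.Any.Properties as Any
open import Data.List.Relation.Unary.Linked using (Linked; [-]; _∷_)
open import Data.List.Relation.Unary.Linked.Properties using (Linked⇒AllPairs)
open import Data.List.Relation.Unary.Sorted.TotalOrder ℤ.≤-totalOrder using (Sorted)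
open import Data.List.Relation.Unary.Sorted.TotalOrder.Properties using (merge⁺)
open import Data.List.Relation.Unary.Unique.Propositional using (Unique)
open import Data.Nat as ℕ using (ℕ; zero; suc; z≤n; s≤s; _*_; _≤_; _∸_; NonZero)
import Data.Nat.DivMod as ℕ
import Data.Nat.Divisibility as ℕ
open import Data.Nat.Induction using (<-rec)
open import Data.Nat.ListAction using (sum)
open import Data.Nat.Logarithm using (⌈log₂_⌉; ⌈log₂⌉-mono-≤; ⌈log₂⌈n/2⌉⌉≡⌈log₂n⌉∸1)
import Data.Nat.Properties as ℕ
open import Data.Nat.Solver using (module +-*-Solver)
open import Data.Product using (Σ; ∃; ∃₂; _×_; _,_; proj₁; proj₂)
open import Data.Sum as Sum using (_⊎_; inj₁; inj₂)
open import Data.Unit using (⊤; tt)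
open import Data.Vec as Vec using (Vec; []; _∷_)
import Data.Vec.Properties as Vec
open import Function using (Equivalence; _∘_; id; mk⇔)
open import Relation.Binary using (tri<; tri≈; tri>)
open import Relation.Binary.Construct.Closure.ReflexiveTransitive as Star using (Star; ε; _◅_)
open import Relation.Binary.PropositionalEquality
open import Relation.Nullary using (¬_; Dec; yes; no; contradiction)
open import Relation.Nullary.Decidable using (True; ⌊_⌋; _×-dec_; _⊎-dec_; toWitness)

-- Subsets and independence numbers

∈-tabulate⁺ : ∀ {n} {P : Fin n → Set} (P? : ∀ v → Dec (P v)) {v} →
  P v → v ∈ Vec.tabulate (λ v → ⌊ P? v ⌋)
∈-tabulate⁺ P? {v} p with P? v in eq
... | no ¬p = contradiction p ¬p
... | yes _ = Vec.lookup⇒[]= v _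
      (trans (Vec.lookup∘tabulate (λ v → ⌊ P? v ⌋) v) (cong ⌊_⌋ eq))

∈-tabulate⁻ : ∀ {n} {P : Fin n → Set} (P? : ∀ v → Dec (P v)) {v} →
  v ∈ Vec.tabulate (λ v → ⌊ P? v ⌋) → P v
∈-tabulate⁻ P? {v} v∈ with P? v in eq
... | yes p = p
... | no _ with trans (sym (Vec.[]=⇒lookup v∈))
                      (trans (Vec.lookup∘tabulate (λ v → ⌊ P? v ⌋) v) (cong ⌊_⌋ eq))
...   | ()

elements : ∀ {n} (I : Subset n) → Fin ∣ I ∣ → Fin n
elements (inside  ∷ I) zero    = zero
elements (inside  ∷ I) (suc i) = suc (elements I i)
elements (outside ∷ I) i       = suc (elements I i)

elements-∈ : ∀ {n} (I : Subset n) i → elements I i ∈ I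
elements-∈ (inside  ∷ I) zero    = Vec.here
elements-∈ (inside  ∷ I) (suc i) = Vec.there (elements-∈ I i)
elements-∈ (outside ∷ I) i       = Vec.there (elements-∈ I i)

elements-injective : ∀ {n} (I : Subset n) {i j} → elements I i ≡ elements I j → i ≡ j
elements-injective (inside  ∷ I) {zero}  {zero}  _  = refl
elements-injective (inside  ∷ I) {suc i} {suc j} eq =
  cong suc (elements-injective I (Fin.suc-injective eq))
elements-injective (outside ∷ I) eq = elements-injective I (Fin.suc-injective eq)

-- Pigeonhole, with a map that may depend on the membership proof: a grid-point or grid-edge is
-- chosen for a vertex only once the vertex is known to lie in `I`.
injection⇒∣∣≤length : ∀ {n} (I : Subset n) {A : Set} (xs : List A)
  (f : ∀ {u} → u ∈ I → A) → (∀ {u} (u∈ : u ∈ I) → f u∈ ∈ₗ xs) →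
  (∀ {u w} (u∈ : u ∈ I) (w∈ : w ∈ I) → f u∈ ≡ f w∈ → u ≡ w) →
  ∣ I ∣ ℕ.≤ length xs
injection⇒∣∣≤length I xs f f∈ inj = Fin.injective⇒≤ {f = g} g-injective
  where
  g : Fin ∣ I ∣ → Fin (length xs)
  g i = Any.index (f∈ (elements-∈ I i))
  g-injective : ∀ {i j} → g i ≡ g j → i ≡ j
  g-injective {i} {j} eq = elements-injective I (inj _ _
    (trans (Any.lookup-index (f∈ (elements-∈ I i)))
    (trans (cong (List.lookup xs) eq) (sym (Any.lookup-index (f∈ (elements-∈ I j)))))))

α≤ : ∀ {n} (G : Graph n) S {b} →
  (∀ I → IndependentIn G S I → ∣ I ∣ ℕ.≤ b) → α G S ℕ.≤ b
α≤ G S h = max≤v⁺ z≤n (All.map⁺ (All.map (λ {I} → h I) (All.all-filter (independentIn? G S) (subsets _))))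

-- If no least element exists, strong induction refutes `P` at every number. `P` is not assumed
-- decidable, hence the double negation.
¬¬-least : ∀ {a} (P : ℕ → Set a) n → P n → ¬ ¬ (∃ λ m → P m × (∀ w → P w → m ℕ.≤ w))
¬¬-least P n pn no-least = <-rec (λ m → ¬ P m)
  (λ m rec pm → no-least (m , pm , λ w pw → ℕ.≮⇒≥ (λ w<m → rec w<m pw))) n pn

-- Reflection `w ↦ b ∸ w` turns a greatest element below `b` into a least one.
¬¬-greatest : ∀ {a} (P : ℕ → Set a) b → (∀ w → P w → w ℕ.≤ b) → ∀ n → P n →
  ¬ ¬ (∃ λ m → P m × (∀ w → P w → w ℕ.≤ m))
¬¬-greatest P b P≤b n pn no-greatest =
  ¬¬-least (λ d → P (b ∸ d)) (b ∸ n) (subst P (sym (ℕ.m∸[m∸n]≡n (P≤b n pn))) pn)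
    λ (d , pd , d-least) → no-greatest (b ∸ d , pd , λ w pw →
      subst (ℕ._≤ b ∸ d) (ℕ.m∸[m∸n]≡n (P≤b w pw))
        (ℕ.∸-monoʳ-≤ b (d-least (b ∸ w) (subst P (sym (ℕ.m∸[m∸n]≡n (P≤b w pw))) pw))))

-- Two extrema are needed, both up to double negation: the width of the given pair is a maximum over
-- infinitely many layer indices, and the layered tree-independence number is the minimum of all
-- widths.
width-bound : ∀ {n} {G : Graph n} (𝒯 : TreeDecomposition G) (L : Layering G) {b} →
  (∀ t i → α G (bag 𝒯 t ∩ layer L i) ℕ.≤ b) → LayeredTreeIndependenceNumber≤ G b
width-bound {G = G} 𝒯 L {b} α≤b ¬ltin =
  ¬¬-greatest (λ w → ∃₂ λ t i → α G (bag 𝒯 t ∩ layer L i) ≡ w) b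
    -- The root bag and layer 0 give an attained value from which the search for the greatest one
    -- starts.
    (λ { w (t , i , refl) → α≤b t i }) _ (root , 0 , refl)
    λ { (m , (t , i , eq) , m-greatest) →
      ¬¬-least (λ w → ∃₂ λ (𝒯 : TreeDecomposition G) (L : Layering G) → IsWidth 𝒯 L w) m
        (𝒯 , L , (t , i , eq) , λ t i → m-greatest _ (t , i , refl))
        λ (r , r-width , r-least) → ¬ltin
          ( r
          , (r-width , λ 𝒯 L w w-width → r-least w (𝒯 , L , w-width))
          , ℕ.≤-trans (r-least m (𝒯 , L , (t , i , eq) , λ t i → m-greatest _ (t , i , refl)))
              (subst (ℕ._≤ b) eq (α≤b t i))) }
  where
  root : Fin (nodes 𝒯)
  root = fromℕ< (IsTree.nonempty (TreeDecomposition.isTree 𝒯))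

-- Path decompositions from intervals

pathGraph : ∀ m → Graph m
pathGraph m = record
  { Adj    = λ s t → toℕ t ≡ suc (toℕ s) ⊎ toℕ s ≡ suc (toℕ t)
  ; adj?   = λ s t → (toℕ t ℕ.≟ suc (toℕ s)) ⊎-dec (toℕ s ℕ.≟ suc (toℕ t))
  ; sym    = Sum.swap
  ; irrefl = λ { (inj₁ eq) → ℕ.1+n≢n (sym eq) ; (inj₂ eq) → ℕ.1+n≢n (sym eq) }
  }

-- A walk without repetitions never reverses, so it moves away from its start.
module _ {m : ℕ} where

  ascending-walk-escapes : ∀ (v x y : Fin m) zs → toℕ v ℕ.< toℕ x → toℕ y ≡ suc (toℕ x) →
    Unique (x ∷ y ∷ zs) → ¬ Linked (Adj (pathGraph m)) (y ∷ zs ++ v ∷ [])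
  ascending-walk-escapes v x y [] v<x y≡ _ (inj₁ v≡ ∷ _) =
    ℕ.<-irrefl refl (ℕ.<-trans v<x (subst (toℕ x ℕ.<_) (trans (cong suc (sym y≡)) (sym v≡)) (ℕ.m≤n⇒m≤1+n ℕ.≤-refl)))
  ascending-walk-escapes v x y [] v<x y≡ _ (inj₂ y≡′ ∷ _) =
    ℕ.<-irrefl (ℕ.suc-injective (trans (sym y≡′) y≡)) v<x
  ascending-walk-escapes v x y (z ∷ zs) v<x y≡ (_ ∷ uniq) (inj₁ z≡ ∷ walk) =
    ascending-walk-escapes v y z zs (ℕ.<-trans v<x (ℕ.≤-reflexive (sym y≡))) z≡ uniq walk
  ascending-walk-escapes v x y (z ∷ zs) v<x y≡ ((_ ∷ x≢z ∷ _) ∷ _) (inj₂ y≡′ ∷ _) =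
    x≢z (Fin.toℕ-injective (ℕ.suc-injective (trans (sym y≡) y≡′)))

  descending-walk-escapes : ∀ (v x y : Fin m) zs → toℕ x ℕ.< toℕ v → toℕ x ≡ suc (toℕ y) →
    Unique (x ∷ y ∷ zs) → ¬ Linked (Adj (pathGraph m)) (y ∷ zs ++ v ∷ [])
  descending-walk-escapes v x y [] x<v x≡ _ (inj₂ y≡ ∷ _) =
    ℕ.<-irrefl refl (ℕ.<-trans x<v (subst (toℕ v ℕ.<_) (trans (cong suc (sym y≡)) (sym x≡)) (ℕ.m≤n⇒m≤1+n ℕ.≤-refl)))
  descending-walk-escapes v x y [] x<v x≡ _ (inj₁ v≡ ∷ _) =
    ℕ.<-irrefl (trans x≡ (sym v≡)) x<v
  descending-walk-escapes v x y (z ∷ zs) x<v x≡ (_ ∷ uniq) (inj₂ y≡ ∷ walk) =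
    descending-walk-escapes v y z zs (ℕ.<-trans (ℕ.≤-reflexive (sym x≡)) x<v) y≡ uniq walk
  descending-walk-escapes v x y (z ∷ zs) x<v x≡ ((_ ∷ x≢z ∷ _) ∷ _) (inj₁ z≡ ∷ _) =
    x≢z (Fin.toℕ-injective (trans x≡ (sym z≡)))

  pathGraph-acyclic : ¬ Cycle (pathGraph m)
  pathGraph-acyclic (v , [] , () , _)
  pathGraph-acyclic (v , _ ∷ [] , s≤s () , _)
  pathGraph-acyclic (v , a ∷ b ∷ zs , _ , (_ ∷ v≢b ∷ _) ∷ uniq , inj₁ a≡ ∷ inj₁ b≡ ∷ walk) =
    ascending-walk-escapes v a b zs (ℕ.≤-reflexive (sym a≡)) b≡ uniq walk
  pathGraph-acyclic (v , a ∷ b ∷ zs , _ , (_ ∷ v≢b ∷ _) ∷ _ , inj₁ a≡ ∷ inj₂ a≡′ ∷ _) =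
    v≢b (Fin.toℕ-injective (ℕ.suc-injective (trans (sym a≡) a≡′)))
  pathGraph-acyclic (v , a ∷ b ∷ zs , _ , (_ ∷ v≢b ∷ _) ∷ _ , inj₂ v≡ ∷ inj₁ b≡ ∷ _) =
    v≢b (Fin.toℕ-injective (trans v≡ (sym b≡)))
  pathGraph-acyclic (v , a ∷ b ∷ zs , _ , _ ∷ uniq , inj₂ v≡ ∷ inj₂ a≡ ∷ walk) =
    descending-walk-escapes v a b zs (ℕ.≤-reflexive (sym v≡)) a≡ uniq walk

  walk-up : (Q : Fin m → Set) → ∀ d (s t : Fin m) → toℕ t ≡ d ℕ.+ toℕ s →
    (∀ r → toℕ s ℕ.≤ toℕ r → toℕ r ℕ.≤ toℕ t → Q r) →
    Star (λ a b → Adj (pathGraph m) a b × Q a × Q b) s t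
  walk-up Q zero    s t eq q with Fin.toℕ-injective eq
  ... | refl = ε
  walk-up Q (suc d) s t eq q = (inj₁ s′≡ , q s ℕ.≤-refl s≤t , q s′ s≤s′ s′≤t)
      ◅ walk-up Q d s′ t (trans eq (trans (sym (ℕ.+-suc d _)) (cong (d ℕ.+_) (sym s′≡))))
          (λ r s′≤r → q r (ℕ.≤-trans s≤s′ s′≤r))
    where
    s<t : toℕ s ℕ.< toℕ t
    s<t = subst (toℕ s ℕ.<_) (sym eq) (s≤s (ℕ.m≤n+m _ d))
    s≤t = ℕ.<⇒≤ s<t
    s′<m = ℕ.≤-<-trans s<t (Fin.toℕ<n t)
    s′ : Fin m
    s′ = fromℕ< s′<m
    s′≡ : toℕ s′ ≡ suc (toℕ s)
    s′≡ = Fin.toℕ-fromℕ< s′<m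
    s≤s′ = ℕ.≤-trans (ℕ.n≤1+n _) (ℕ.≤-reflexive (sym s′≡))
    s′≤t = ℕ.≤-trans (ℕ.≤-reflexive s′≡) s<t

  walk : (Q : Fin m → Set) →
    (∀ {s r t} → toℕ s ℕ.≤ toℕ r → toℕ r ℕ.≤ toℕ t → Q s → Q t → Q r) →
    ∀ s t → Q s → Q t → Star (λ a b → Adj (pathGraph m) a b × Q a × Q b) s t
  walk Q convex s t qs qt with ℕ.≤-total (toℕ s) (toℕ t)
  ... | inj₁ s≤t = walk-up Q _ s t (sym (ℕ.m∸n+n≡m s≤t)) (λ r s≤r r≤t → convex s≤r r≤t qs qt)
  ... | inj₂ t≤s = Star.reverse (λ (adj , qa , qb) → Sum.swap adj , qb , qa)
        (walk-up Q _ t s (sym (ℕ.m∸n+n≡m t≤s)) (λ r t≤r r≤s → convex t≤r r≤s qt qs))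

pathGraph-isTree : ∀ m → IsTree (pathGraph (suc m))
pathGraph-isTree m = record
  { nonempty  = s≤s z≤n
  ; connected = λ s t → Star.map proj₁ (walk (λ _ → ⊤) (λ _ _ _ _ → tt) s t tt tt)
  ; acyclic   = pathGraph-acyclic
  }

module _ {n} (G : Graph n) (m : ℕ) (lo hi : Fin n → ℕ) where

  InRun : Fin n → Fin (suc m) → Set
  InRun v t = lo v ℕ.≤ toℕ t × toℕ t ℕ.≤ hi v

  inRun? : ∀ t v → Dec (InRun v t)
  inRun? t v = (lo v ℕ.≤? toℕ t) ×-dec (toℕ t ℕ.≤? hi v)

  -- Since adjacency is symmetric, the last hypothesis makes the intervals of adjacent vertices
  -- intersect, and the larger of their two left ends is a common node. Coherence is the convexity
  -- of an interval.
  intervalDecomposition : (∀ v → lo v ℕ.≤ hi v) → (∀ v → hi v ℕ.≤ m) →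
    (∀ {u w} → Adj G u w → lo u ℕ.≤ hi w) → TreeDecomposition G
  intervalDecomposition lo≤hi hi≤m adj⇒≤ = record
    { nodes        = suc m
    ; tree         = pathGraph (suc m)
    ; isTree       = pathGraph-isTree m
    ; bag          = λ t → Vec.tabulate (λ v → ⌊ inRun? t v ⌋)
    ; vertex-cover = λ v → node v , ∈-tabulate⁺ (inRun? _) (starts v (lo≤hi v))
    ; edge-cover   = cover
    ; coherent     = λ v s t v∈s v∈t →
        Star.map (λ (adj , qa , qb) → adj , ∈-tabulate⁺ (inRun? _) qa , ∈-tabulate⁺ (inRun? _) qb)
          (walk (InRun v) (λ s≤r r≤t (ls , _) (_ , th) → ℕ.≤-trans ls s≤r , ℕ.≤-trans r≤t th)
            s t (∈-tabulate⁻ (inRun? _) v∈s) (∈-tabulate⁻ (inRun? _) v∈t))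
    }
    where
    lo<1+m : ∀ v → lo v ℕ.< suc m
    lo<1+m v = s≤s (ℕ.≤-trans (lo≤hi v) (hi≤m v))
    node : Fin n → Fin (suc m)
    node v = fromℕ< (lo<1+m v)
    node≡ : ∀ v → toℕ (node v) ≡ lo v
    node≡ v = Fin.toℕ-fromℕ< (lo<1+m v)
    starts : ∀ v {x} → lo v ℕ.≤ x → lo v ℕ.≤ toℕ (node v) × toℕ (node v) ℕ.≤ x
    starts v p = ℕ.≤-reflexive (sym (node≡ v)) , ℕ.≤-trans (ℕ.≤-reflexive (node≡ v)) p
    cover-by : ∀ u w → Adj G u w → lo w ℕ.≤ lo u → InRun u (node u) × InRun w (node u)
    cover-by u w adj w≤u = starts u (lo≤hi u)
      , (ℕ.≤-trans w≤u (proj₁ (starts u (lo≤hi u))) , proj₂ (starts u (adj⇒≤ adj)))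
    cover : ∀ u w → Adj G u w → ∃ λ t → u ∈ Vec.tabulate (λ v → ⌊ inRun? t v ⌋) ×
                                        w ∈ Vec.tabulate (λ v → ⌊ inRun? t v ⌋)
    cover u w adj with ℕ.≤-total (lo w) (lo u)
    ... | inj₁ w≤u = let a , b = cover-by u w adj w≤u in
          node u , ∈-tabulate⁺ (inRun? _) a , ∈-tabulate⁺ (inRun? _) b
    ... | inj₂ u≤w = let a , b = cover-by w u (Graph.sym G adj) u≤w in
          node w , ∈-tabulate⁺ (inRun? _) b , ∈-tabulate⁺ (inRun? _) a

-- Grid paths

lowest highest : (Point → ℤ) → List⁺ Point → ℤ
lowest  c ps = List⁺.foldr₁ ℤ._⊓_ (List⁺.map c ps)
highest c ps = List⁺.foldr₁ ℤ._⊔_ (List⁺.map c ps)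

bottom top : GridPath → ℤ
bottom P = lowest proj₂ (corners P)
top    P = highest proj₂ (corners P)

lowest≤head : ∀ c p ps → lowest c (p ∷ ps) ℤ.≤ c p
lowest≤head c p []       = ℤ.≤-refl
lowest≤head c p (q ∷ ps) = ℤ.i⊓j≤i _ _

head≤highest : ∀ c p ps → c p ℤ.≤ highest c (p ∷ ps)
head≤highest c p []       = ℤ.≤-refl
head≤highest c p (q ∷ ps) = ℤ.i≤i⊔j _ _

lowest≤highest : ∀ c ps → lowest c ps ℤ.≤ highest c ps
lowest≤highest c (p ∷ ps) = ℤ.≤-trans (lowest≤head c p ps) (head≤highest c p ps)

lowest≥ : ∀ c {b} p ps → All (λ q → b ℤ.≤ c q) (p ∷ ps) → b ℤ.≤ lowest c (p ∷ ps)
lowest≥ c p []       (b≤ ∷ [])  = b≤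
lowest≥ c p (q ∷ ps) (b≤ ∷ b≤s) = ℤ.⊓-glb b≤ (lowest≥ c q ps b≤s)

module _ (c : Point → ℤ)
         (c-between : ∀ p q r → OnSegment p q r → Between (c p) (c q) (c r)) where

  -- Abstracting over the coordinate `c` serves both axes with one induction.
  pointOn⇒between : ∀ {r} p ps → PointOn r (p ∷ ps) →
    lowest c (p ∷ ps) ℤ.≤ c r × c r ℤ.≤ highest c (p ∷ ps)
  pointOn⇒between p ps corner = lowest≤head c p ps , head≤highest c p ps
  pointOn⇒between {r} p (q ∷ ps) (inner on) with c-between p q r on
  ... | ⊓≤ , ≤⊔ = ℤ.≤-trans (ℤ.⊓-monoʳ-≤ (c p) (lowest≤head c q ps)) ⊓≤
                , ℤ.≤-trans ≤⊔ (ℤ.⊔-monoʳ-≤ (c p) (head≤highest c q ps))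
  pointOn⇒between p (q ∷ ps) (later on) with pointOn⇒between q ps on
  ... | low≤ , ≤high = ℤ.≤-trans (ℤ.i⊓j≤j _ _) low≤ , ℤ.≤-trans ≤high (ℤ.i≤j⊔i _ _)
  pointOn⇒between p [] (later ())

pointOn⇒horizontal : ∀ P {r} → PointOn r (toList (corners P)) →
  left P ℤ.≤ proj₁ r × proj₁ r ℤ.≤ right P
pointOn⇒horizontal P on with corners P
... | p ∷ ps = pointOn⇒between proj₁ (λ _ _ _ → proj₁) p ps on

pointOn⇒vertical : ∀ P {r} → PointOn r (toList (corners P)) →
  bottom P ℤ.≤ proj₂ r × proj₂ r ℤ.≤ top P
pointOn⇒vertical P on with corners P
... | p ∷ ps = pointOn⇒between proj₂ (λ _ _ _ → proj₂) p ps on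

edgeOn⇒pointOn : ∀ {e ps} → EdgeOn e ps →
  PointOn (proj₁ (ends e)) ps × PointOn (proj₂ (ends e)) ps
edgeOn⇒pointOn (inner a b) = inner a , inner b
edgeOn⇒pointOn (later on)  = let a , b = edgeOn⇒pointOn on in later a , later b

share⇒common-point : ∀ x {P Q} → Share x P Q →
  ∃ λ r → PointOn r (toList (corners P)) × PointOn r (toList (corners Q))
share⇒common-point vpg share = share
share⇒common-point epg (e , onP , onQ) =
  _ , proj₁ (edgeOn⇒pointOn onP) , proj₁ (edgeOn⇒pointOn onQ)

-- Where a path crosses a horizontal line

data Side (p q : Point) : List Point → Set where
  here  : ∀ {ps} → Side p q (p ∷ q ∷ ps)
  there : ∀ {r ps} → Side p q ps → Side p q (r ∷ ps)

side-point : ∀ {p q ps r} → Side p q ps → OnSegment p q r → PointOn r ps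
side-point here      on = inner on
side-point (there s) on = later (side-point s on)

side-edge : ∀ {p q ps e} → Side p q ps → OnSegment p q (proj₁ (ends e)) →
  OnSegment p q (proj₂ (ends e)) → EdgeOn e ps
side-edge here      a b = inner a b
side-edge (there s) a b = later (side-edge s a b)

-- A discrete intermediate value argument. If `y` is in the vertical range of the remaining corners,
-- recursion finds the side; otherwise these corners all lie strictly on one side of `y`, the first
-- corner does not, and the first side crosses.
crossing-side : ∀ {d} y p q ps → Rectilinear d (p ∷ q ∷ ps) →
  lowest proj₂ (p ∷ q ∷ ps) ℤ.≤ y → y ℤ.≤ highest proj₂ (p ∷ q ∷ ps) →
  ∃₂ λ a b → Side a b (p ∷ q ∷ ps) × (∃ λ d → Segment d a b) × Between (proj₂ a) (proj₂ b) y
crossing-side y p q [] (step seg _) low≤y y≤high = p , q , here , (_ , seg) , low≤y , y≤high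
crossing-side y p q (r ∷ ps) (step seg rect) low≤y y≤high
  with lowest proj₂ (q ∷ r ∷ ps) ℤ.≤? y | y ℤ.≤? highest proj₂ (q ∷ r ∷ ps)
... | yes low≤ | yes ≤high =
      let a , b , side , rest = crossing-side y q r ps rect low≤ ≤high in
      a , b , there side , rest
... | no low≰ | _ = p , q , here , (_ , seg)
      , ℤ.≤-trans (ℤ.i⊓j≤i _ _) p≤y
      , ℤ.≤-trans (ℤ.<⇒≤ (ℤ.≰⇒> low≰))
          (ℤ.≤-trans (lowest≤head proj₂ q (r ∷ ps)) (ℤ.i≤j⊔i _ _))
      where
      p≤y : proj₂ p ℤ.≤ y
      p≤y with ℤ.⊓-sel (proj₂ p) (lowest proj₂ (q ∷ r ∷ ps))
      ... | inj₁ eq = subst (ℤ._≤ y) eq low≤y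
      ... | inj₂ eq = contradiction (subst (ℤ._≤ y) eq low≤y) low≰
... | yes _ | no ≰high = p , q , here , (_ , seg)
      , ℤ.≤-trans (ℤ.i⊓j≤j _ _)
          (ℤ.≤-trans (head≤highest proj₂ q (r ∷ ps)) (ℤ.<⇒≤ (ℤ.≰⇒> ≰high)))
      , ℤ.≤-trans y≤p (ℤ.i≤i⊔j _ _)
      where
      y≤p : y ℤ.≤ proj₂ p
      y≤p with ℤ.⊔-sel (proj₂ p) (highest proj₂ (q ∷ r ∷ ps))
      ... | inj₁ eq = subst (y ℤ.≤_) eq y≤high
      ... | inj₂ eq = contradiction (subst (y ℤ.≤_) eq y≤high) ≰high

between-left : ∀ a b → Between a b a
between-left a b = ℤ.i⊓j≤i a b , ℤ.i≤i⊔j a b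

between-right : ∀ a b → Between a b b
between-right a b = ℤ.i⊓j≤j a b , ℤ.i≤j⊔i a b

crossing-point : ∀ P y → bottom P ℤ.≤ y → y ℤ.≤ top P →
  ∃ λ x → PointOn (x , y) (toList (corners P))
crossing-point P y bottom≤y y≤top with corners P | GridPath.rectilinear P
... | (x , y₀) ∷ []     | _ with ℤ.≤-antisym bottom≤y y≤top
...   | refl = x , corner
crossing-point P y bottom≤y y≤top | p ∷ q ∷ ps | d , rect
  with crossing-side y p q ps rect bottom≤y y≤top
... | a , b , side , _ , between =
      proj₁ a , side-point side (between-left (proj₁ a) (proj₁ b) , between)

-- The edges incident to a grid-point of the line, in the three kinds that `resources` counts
-- separately.
data MeetsLine (y : ℤ) : GridEdge → Set where
  along : ∀ {x} → MeetsLine y ((x , y) , horizontal)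
  above : ∀ {x} → MeetsLine y ((x , y) , vertical)
  below : ∀ {x} → MeetsLine y ((x , ℤ.pred y) , vertical)

-- A horizontal segment offers its leftmost edge. A vertical one offers the edge upward from `y` or,
-- when `y` is its upper end, the edge downward, for which there is room because the segment is not
-- degenerate.
segment-edge : ∀ d a b {y} → Segment d a b → Between (proj₂ a) (proj₂ b) y →
  ∃ λ e → OnSegment a b (proj₁ (ends e)) × OnSegment a b (proj₂ (ends e)) × MeetsLine y e
segment-edge horizontal (x , _) (x′ , _) {y} (x≢x′ , refl) between with ℤ.<-cmp x x′
... | tri< x<x′ _ _ = ((x , y) , horizontal)
      , (between-left x x′ , between)
      , ((ℤ.≤-trans (ℤ.i⊓j≤i x x′) (ℤ.i≤suc[i] x) , ℤ.≤-trans (ℤ.i<j⇒suc[i]≤j x<x′) (ℤ.i≤j⊔i x x′)) , between)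
      , along
... | tri≈ _ x≡x′ _ = contradiction x≡x′ x≢x′
... | tri> _ _ x′<x = ((x′ , y) , horizontal)
      , (between-right x x′ , between)
      , ((ℤ.≤-trans (ℤ.i⊓j≤j x x′) (ℤ.i≤suc[i] x′) , ℤ.≤-trans (ℤ.i<j⇒suc[i]≤j x′<x) (ℤ.i≤i⊔j x x′)) , between)
      , along
segment-edge vertical (x , y₀) (_ , y₁) {y} (refl , y₀≢y₁) (min≤y , y≤max) with y ℤ.<? y₀ ℤ.⊔ y₁
... | yes y<max = ((x , y) , vertical)
      , (between-left x x , min≤y , y≤max)
      , (between-left x x , ℤ.≤-trans min≤y (ℤ.i≤suc[i] y) , ℤ.i<j⇒suc[i]≤j y<max)
      , above
... | no y≮max = ((x , ℤ.pred y) , vertical)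
      , (between-left x x , min≤pred , ℤ.≤-trans (ℤ.i≤j⇒pred[i]≤j ℤ.≤-refl) y≤max)
      , subst (λ z → OnSegment (x , y₀) (x , y₁) (x , z)) (sym (ℤ.suc-pred y))
          (between-left x x , min≤y , y≤max)
      , below
      where
      min≢max : y₀ ℤ.⊓ y₁ ≢ y₀ ℤ.⊔ y₁
      min≢max eq = y₀≢y₁ (ℤ.≤-antisym
        (ℤ.≤-trans (ℤ.i≤i⊔j y₀ y₁) (ℤ.≤-trans (ℤ.≤-reflexive (sym eq)) (ℤ.i⊓j≤j y₀ y₁)))
        (ℤ.≤-trans (ℤ.i≤j⊔i y₀ y₁) (ℤ.≤-trans (ℤ.≤-reflexive (sym eq)) (ℤ.i⊓j≤i y₀ y₁))))
      max≤y = ℤ.≮⇒≥ y≮max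
      min≤pred : y₀ ℤ.⊓ y₁ ℤ.≤ ℤ.pred y
      min≤pred = ℤ.i<j⇒i≤pred[j] (ℤ.≤∧≢⇒< min≤y
        (λ min≡y → min≢max (ℤ.≤-antisym (ℤ.i⊓j≤i⊔j y₀ y₁) (ℤ.≤-trans max≤y (ℤ.≤-reflexive (sym min≡y))))))

Trivial : GridPath → Set
Trivial P = ∃ λ p → toList (corners P) ≡ p ∷ []

crossing-edge : ∀ P y → ¬ Trivial P → bottom P ℤ.≤ y → y ℤ.≤ top P →
  ∃ λ e → EdgeOn e (toList (corners P)) × MeetsLine y e
crossing-edge P y ¬trivial bottom≤y y≤top with corners P | GridPath.rectilinear P
... | p ∷ []     | _ = contradiction (p , refl) ¬trivial
... | p ∷ q ∷ ps | d , rect with crossing-side y p q ps rect bottom≤y y≤top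
...   | a , b , side , (d′ , seg) , between with segment-edge d′ a b seg between
...     | e , on₁ , on₂ , meets = e , side-edge side on₁ on₂ , meets

-- Points and edges inside a window of columns

columns : ℤ → ℕ → List ℤ
columns x₀ m = List.map (λ i → x₀ ℤ.+ + i) (upTo m)

length-map-columns : ∀ {A : Set} (f : ℤ → A) x₀ m → length (List.map f (columns x₀ m)) ≡ m
length-map-columns f x₀ m = trans (List.length-map f (columns x₀ m))
  (trans (List.length-map (λ i → x₀ ℤ.+ + i) (upTo m)) (List.length-upTo m))

length-columns-++ : ∀ {A : Set} (f : ℤ → A) x₀ m ys {k} → length ys ≡ k →
  length (List.map f (columns x₀ m) ++ ys) ≡ m ℕ.+ k
length-columns-++ f x₀ m ys refl = trans (List.length-++ (List.map f (columns x₀ m)))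
  (cong (ℕ._+ length ys) (length-map-columns f x₀ m))

nonneg⇒∣∣ : ∀ {x x₀} → x₀ ℤ.≤ x → + ℤ.∣ x ℤ.- x₀ ∣ ≡ x ℤ.- x₀
nonneg⇒∣∣ x₀≤x = ℤ.0≤i⇒+∣i∣≡i (ℤ.i≤j⇒0≤j-i x₀≤x)

i+[j-i]≡j : ∀ i j → i ℤ.+ (j ℤ.- i) ≡ j
i+[j-i]≡j i j = trans (ℤ.+-comm i (j ℤ.- i)) (trans (ℤ.+-assoc j (ℤ.- i) i)
  (trans (cong (λ k → j ℤ.+ k) (ℤ.+-inverseˡ i)) (ℤ.+-identityʳ j)))

split-offset : ∀ {x₀ x} → x₀ ℤ.≤ x → x ≡ x₀ ℤ.+ + ℤ.∣ x ℤ.- x₀ ∣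
split-offset {x₀} {x} x₀≤x =
  sym (trans (cong (λ z → x₀ ℤ.+ z) (nonneg⇒∣∣ x₀≤x)) (i+[j-i]≡j x₀ x))

pred-offset : ∀ x m → ℤ.pred (x ℤ.+ + suc m) ≡ x ℤ.+ + m
pred-offset x m = trans (cong ℤ.pred (trans (ℤ.+-comm x (+ suc m))
  (trans (ℤ.suc-+ m x) (cong ℤ.suc (ℤ.+-comm (+ m) x))))) (ℤ.pred-suc _)

offset-cancel-≤ : ∀ x {a b} → x ℤ.+ + a ℤ.≤ x ℤ.+ + b → a ℕ.≤ b
offset-cancel-≤ x le = ℕ.≮⇒≥ λ b<a → ℤ.<⇒≱ (ℤ.+-monoʳ-< x (ℤ.+<+ b<a)) le

offset-cancel-< : ∀ x {a b} → x ℤ.+ + a ℤ.< x ℤ.+ + b → a ℕ.< b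
offset-cancel-< x lt = ℕ.≰⇒> λ b≤a → ℤ.<⇒≱ lt (ℤ.+-monoʳ-≤ x (ℤ.+≤+ b≤a))

∈-columns : ∀ {x₀ x m} → x₀ ℤ.≤ x → x ℤ.< x₀ ℤ.+ + m → x ∈ₗ columns x₀ m
∈-columns {x₀} {x} {m} x₀≤x x<x₀+m = subst (_∈ₗ columns x₀ m) (sym (split-offset x₀≤x))
  (∈-map⁺ (λ i → x₀ ℤ.+ + i) (∈-upTo⁺ (offset-cancel-< x₀
    (subst (ℤ._< x₀ ℤ.+ + m) (split-offset x₀≤x) x<x₀+m))))

Resource : Mode → Set
Resource vpg = Point
Resource epg = GridEdge

-- What a path confined to the `2ℓ` columns from `x₀` can use at height `y`. A horizontal edge is
-- listed by its left end; its right end must also lie in the window, which removes one column.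
resources : (x : Mode) → ℤ → ℕ → ℤ → List (Resource x)
resources vpg x₀ ℓ y = List.map (_, y) (columns x₀ (2 ℕ.* ℓ))
resources epg x₀ ℓ y =
  List.map (λ x → (x , y) , horizontal) (columns x₀ (2 ℕ.* ℓ ∸ 1)) ++
  List.map (λ x → (x , y) , vertical) (columns x₀ (2 ℕ.* ℓ)) ++
  List.map (λ x → (x , ℤ.pred y) , vertical) (columns x₀ (2 ℕ.* ℓ))

length-resources : ∀ x x₀ ℓ y → 1 ℕ.≤ ℓ → length (resources x x₀ ℓ y) ≡ bound x ℓ
length-resources vpg x₀ ℓ y _ = length-map-columns (_, y) x₀ (2 ℕ.* ℓ)
length-resources epg x₀ ℓ y 1≤ℓ = begin
  length (resources epg x₀ ℓ y)
    ≡⟨ length-columns-++ (λ x → (x , y) , horizontal) x₀ (2 ℕ.* ℓ ∸ 1) _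
        (length-columns-++ (λ x → (x , y) , vertical) x₀ (2 ℕ.* ℓ) _
          (length-map-columns (λ x → (x , ℤ.pred y) , vertical) x₀ (2 ℕ.* ℓ))) ⟩
  (2 ℕ.* ℓ ∸ 1) ℕ.+ (2 ℕ.* ℓ ℕ.+ 2 ℕ.* ℓ)
    ≡⟨ ℕ.+-∸-comm (2 ℕ.* ℓ ℕ.+ 2 ℕ.* ℓ) (ℕ.≤-trans 1≤ℓ (ℕ.m≤m+n ℓ _)) ⟨
  2 ℕ.* ℓ ℕ.+ (2 ℕ.* ℓ ℕ.+ 2 ℕ.* ℓ) ∸ 1
    ≡⟨ cong (_∸ 1) (solve 1 (λ l → con 2 :* l :+ (con 2 :* l :+ con 2 :* l) := con 6 :* l) refl ℓ) ⟩
  6 ℕ.* ℓ ∸ 1 ∎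
  where
  open ≡-Reasoning
  open +-*-Solver

Uses : (x : Mode) → Resource x → GridPath → Set
Uses vpg r P = PointOn r (toList (corners P))
Uses epg e P = EdgeOn e (toList (corners P))

uses⇒share : ∀ x {P Q} (r : Resource x) → Uses x r P → Uses x r Q → Share x P Q
uses⇒share vpg r p q = r , p , q
uses⇒share epg r p q = r , p , q

Isolated : Mode → GridPath → Set
Isolated vpg P = ⊥
Isolated epg P = Trivial P

isolated⇒no-share : ∀ x {P Q} → Isolated x P → ¬ Share x P Q
isolated⇒no-share epg {P} (p , _) (e , onP , _) with corners P
isolated⇒no-share epg {P} (p , refl) (e , later () , _) | _ ∷ []

crossing-resource : ∀ x P {x₀ ℓ y} → 1 ℕ.≤ ℓ → ¬ Isolated x P → bottom P ℤ.≤ y → y ℤ.≤ top P →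
  x₀ ℤ.≤ left P → right P ℤ.< x₀ ℤ.+ + (2 ℕ.* ℓ) →
  ∃ λ r → r ∈ₗ resources x x₀ ℓ y × Uses x r P
crossing-resource vpg P {y = y} _ _ b≤y y≤t x₀≤left right< with crossing-point P y b≤y y≤t
... | x , on = let l≤x , x≤r = pointOn⇒horizontal P on in
      (x , y) , ∈-map⁺ (_, y) (∈-columns (ℤ.≤-trans x₀≤left l≤x) (ℤ.≤-<-trans x≤r right<)) , on
crossing-resource epg P {x₀} {ℓ} {y} 1≤ℓ ¬isolated b≤y y≤t x₀≤left right<
  with crossing-edge P y ¬isolated b≤y y≤t
... | e , on , meets = e , ∈-resources meets (edgeOn⇒pointOn on) , on
  where
  in-window : ∀ {r} → PointOn r (toList (corners P)) → proj₁ r ∈ₗ columns x₀ (2 ℕ.* ℓ)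
  in-window on = let l≤x , x≤r = pointOn⇒horizontal P on in
    ∈-columns (ℤ.≤-trans x₀≤left l≤x) (ℤ.≤-<-trans x≤r right<)
  2ℓ≡ : 2 ℕ.* ℓ ≡ suc (2 ℕ.* ℓ ∸ 1)
  2ℓ≡ = sym (ℕ.m+[n∸m]≡n (ℕ.≤-trans 1≤ℓ (ℕ.m≤m+n ℓ _)))
  ∈-resources : ∀ {e} → MeetsLine y e →
    PointOn (proj₁ (ends e)) (toList (corners P)) × PointOn (proj₂ (ends e)) (toList (corners P)) →
    e ∈ₗ resources epg x₀ ℓ y
  -- The right end of the edge lies before column `x₀ + 2ℓ`, so the left end lies before
  -- `x₀ + (2ℓ - 1)`.
  ∈-resources {e} along (on₁ , on₂) = ∈-++⁺ˡ (∈-map⁺ _ (∈-columns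
      (ℤ.≤-trans x₀≤left (proj₁ (pointOn⇒horizontal P on₁)))
      (ℤ.suc[i]≤j⇒i<j (ℤ.≤-trans (ℤ.i<j⇒i≤pred[j] (ℤ.≤-<-trans (proj₂ (pointOn⇒horizontal P on₂)) right<))
        (ℤ.≤-reflexive (trans (cong (λ m → ℤ.pred (x₀ ℤ.+ + m)) 2ℓ≡)
          (pred-offset x₀ (2 ℕ.* ℓ ∸ 1))))))))
  ∈-resources above (on₁ , _) = ∈-++⁺ʳ (List.map _ (columns x₀ (2 ℕ.* ℓ ∸ 1)))
    (∈-++⁺ˡ (∈-map⁺ _ (in-window on₁)))
  ∈-resources below (on₁ , _) = ∈-++⁺ʳ (List.map _ (columns x₀ (2 ℕ.* ℓ ∸ 1)))
    (∈-++⁺ʳ (List.map _ (columns x₀ (2 ℕ.* ℓ))) (∈-map⁺ _ (in-window on₁)))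

-- Ranks and a common height

rank : List ℤ → ℤ → ℕ
rank bs y = length (List.filter (ℤ._≤? y) bs)

rank-mono : ∀ bs {y z} → y ℤ.≤ z → rank bs y ℕ.≤ rank bs z
rank-mono []       y≤z = z≤n
rank-mono (b ∷ bs) {y} {z} y≤z with b ℤ.≤? y | b ℤ.≤? z
... | yes _   | yes _  = s≤s (rank-mono bs y≤z)
... | yes b≤y | no b≰z = contradiction (ℤ.≤-trans b≤y y≤z) b≰z
... | no _    | yes _  = ℕ.m≤n⇒m≤1+n (rank-mono bs y≤z)
... | no _    | no _   = rank-mono bs y≤z

b-1≤b : ∀ b → b ℤ.- + 1 ℤ.≤ b
b-1≤b b = ℤ.i-j≤i b (+ 1)

-- The occurrence of `b` is counted at `b` but not at `b - 1`. This makes intervals that intersect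
-- still intersect after their ends are replaced by ranks.
rank-strict : ∀ {b} bs → b ∈ₗ bs → rank bs (b ℤ.- + 1) ℕ.< rank bs b
rank-strict {b} (_ ∷ bs) (here refl) with b ℤ.≤? b ℤ.- + 1 | b ℤ.≤? b
... | yes b≤ | _ = contradiction b≤ (ℤ.<⇒≱ (ℤ.i≤pred[j]⇒i<j (ℤ.≤-reflexive (ℤ.+-comm b (ℤ.- + 1)))))
... | no _ | yes _ = s≤s (rank-mono bs (b-1≤b b))
... | no _ | no b≰ = contradiction ℤ.≤-refl b≰
rank-strict {b} (c ∷ bs) (there b∈) with c ℤ.≤? b ℤ.- + 1 | c ℤ.≤? b
... | yes _ | yes _ = s≤s (rank-strict bs b∈)
... | yes c≤ | no c≰ = contradiction (ℤ.≤-trans c≤ (b-1≤b b)) c≰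
... | no _ | yes _ = ℕ.m≤n⇒m≤1+n (rank-strict bs b∈)
... | no _ | no _ = rank-strict bs b∈

upper-bound : ∀ {n} (I : Subset n) (f : Fin n → ℤ) y₀ → ∃ λ y → y₀ ℤ.≤ y ×
  (∀ {u} → u ∈ I → f u ℤ.≤ y) × (∀ {z} → y₀ ℤ.≤ z → (∀ {u} → u ∈ I → f u ℤ.≤ z) → y ℤ.≤ z)
upper-bound [] f y₀ = y₀ , ℤ.≤-refl , (λ ()) , λ y₀≤z _ → y₀≤z
upper-bound (outside ∷ I) f y₀ with upper-bound I (f ∘ suc) y₀
... | y , y₀≤ , f≤ , least = y , y₀≤ , (λ { (Vec.there u∈) → f≤ u∈ }) ,
      λ y₀≤z f≤z → least y₀≤z (f≤z ∘ Vec.there)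
upper-bound (inside ∷ I) f y₀ with upper-bound I (f ∘ suc) (y₀ ℤ.⊔ f zero)
... | y , y₀≤ , f≤ , least = y , ℤ.≤-trans (ℤ.i≤i⊔j _ _) y₀≤ ,
      (λ { Vec.here → ℤ.≤-trans (ℤ.i≤j⊔i _ _) y₀≤ ; (Vec.there u∈) → f≤ u∈ }) ,
      λ y₀≤z f≤z → least (ℤ.⊔-lub y₀≤z (f≤z Vec.here)) (f≤z ∘ Vec.there)

-- Helly's theorem on the line: the largest lower end lies in every interval.
common-height : ∀ {n} (I : Subset n) (b t : Fin n → ℤ) →
  (∀ {u w} → u ∈ I → w ∈ I → b u ℤ.≤ t w) → ∃ λ y → ∀ {u} → u ∈ I → b u ℤ.≤ y × y ℤ.≤ t u
common-height I b t b≤t with nonempty? I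
... | no empty = + 0 , λ u∈ → contradiction (_ , u∈) empty
... | yes (v , v∈) with upper-bound I b (b v)
...   | y , _ , b≤y , least = y , λ u∈ → b≤y u∈ , least (b≤t v∈ u∈) (λ w∈ → b≤t w∈ u∈)

-- The layered tree decomposition

level : Mode → List Point → ℕ → ℕ → ℕ
level epg []      i s = i
level epg (_ ∷ _) i s = s
level vpg _       i s = s

-- Indices below `n` are reserved for isolated vertices, which are numbered by themselves; the slabs
-- are numbered from `n` on.
layerIndex : (ℓ : ℕ) .{{_ : NonZero ℓ}} → Mode → ℕ → ℤ → ℕ → GridPath → ℕ
layerIndex ℓ x n xmin i P =
  level x (List⁺.tail (corners P)) i (n ℕ.+ ℤ.∣ left P ℤ.- xmin ∣ ℕ./ ℓ)

layerIndex-cases : ∀ ℓ .{{_ : NonZero ℓ}} x n xmin i P →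
  (Isolated x P × layerIndex ℓ x n xmin i P ≡ i) ⊎
  (¬ Isolated x P × layerIndex ℓ x n xmin i P ≡ n ℕ.+ ℤ.∣ left P ℤ.- xmin ∣ ℕ./ ℓ)
layerIndex-cases ℓ vpg n xmin i P = inj₂ (id , refl)
layerIndex-cases ℓ epg n xmin i P with corners P
... | p ∷ []    = inj₁ ((p , refl) , refl)
... | _ ∷ _ ∷ _ = inj₂ ((λ { (_ , ()) }) , refl)

module Decomposition {n} {G : Graph n} (R : GridRepresentation G) (ℓ : ℕ) (1≤ℓ : 1 ℕ.≤ ℓ)
  (short : ∀ u → horizontalLength (path R u) ℤ.≤ + ℓ) where

  instance
    nonZero : NonZero ℓ
    nonZero = ℕ.>-nonZero 1≤ℓ

  bottoms : List ℤ
  bottoms = List.tabulate (bottom ∘ path R)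

  lo hi : Fin n → ℕ
  lo v = suc (rank bottoms (bottom (path R v) ℤ.- + 1))
  hi v = rank bottoms (top (path R v))

  lo≤hi-of-≤ : ∀ {u w} → bottom (path R u) ℤ.≤ top (path R w) → lo u ℕ.≤ hi w
  lo≤hi-of-≤ {u} b≤t =
    ℕ.≤-trans (rank-strict bottoms (Membership.∈-tabulate⁺ u)) (rank-mono bottoms b≤t)

  rank≤n : ∀ y → rank bottoms y ℕ.≤ n
  rank≤n y = ℕ.≤-trans (List.length-filter (ℤ._≤? y) bottoms)
    (ℕ.≤-reflexive (List.length-tabulate (bottom ∘ path R)))

  lo≤hi : ∀ v → lo v ℕ.≤ hi v
  lo≤hi v = lo≤hi-of-≤ (lowest≤highest proj₂ (corners (path R v)))

  xmin : ℤ
  xmin = Grid.xmin (grid R)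

  xmin≤left : ∀ u → xmin ℤ.≤ left (path R u)
  xmin≤left u with corners (path R u) | GridRepresentation.inGrid R u
  ... | p ∷ ps | inside-grid = lowest≥ proj₁ p ps (All.map (proj₁ ∘ proj₁) inside-grid)

  right≤left+ℓ : ∀ u → right (path R u) ℤ.≤ left (path R u) ℤ.+ + ℓ
  right≤left+ℓ u = ℤ.≤-trans (ℤ.≤-reflexive (sym (i+[j-i]≡j (left (path R u)) (right (path R u)))))
    (ℤ.+-monoʳ-≤ (left (path R u)) (short u))

  adjacent⇒≢ : ∀ {u w} → Adj G u w → u ≢ w
  adjacent⇒≢ adj refl = Graph.irrefl G adj

  adjacent⇒share : ∀ {u w} → Adj G u w → Share (mode R) (path R u) (path R w)
  adjacent⇒share {u} {w} adj =
    Equivalence.to (GridRepresentation.adjacent R u w (adjacent⇒≢ adj)) adj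

  adjacent⇒lo≤hi : ∀ {u w} → Adj G u w → lo u ℕ.≤ hi w
  adjacent⇒lo≤hi {u} {w} adj with share⇒common-point (mode R) {path R u} {path R w} (adjacent⇒share adj)
  ... | r , onU , onW = lo≤hi-of-≤ (ℤ.≤-trans (proj₁ (pointOn⇒vertical (path R u) onU))
                                              (proj₂ (pointOn⇒vertical (path R w) onW)))

  offset : Fin n → ℕ
  offset u = ℤ.∣ left (path R u) ℤ.- xmin ∣

  adjacent⇒offset≤ : ∀ {u w} → Adj G u w → offset u ℕ.≤ offset w ℕ.+ ℓ
  adjacent⇒offset≤ {u} {w} adj with share⇒common-point (mode R) {path R u} {path R w} (adjacent⇒share adj)
  ... | r , onU , onW = offset-cancel-≤ xmin (begin
    xmin ℤ.+ + offset u               ≡⟨ split-offset (xmin≤left u) ⟨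
    left (path R u)                   ≤⟨ proj₁ (pointOn⇒horizontal (path R u) onU) ⟩
    proj₁ r                           ≤⟨ proj₂ (pointOn⇒horizontal (path R w) onW) ⟩
    right (path R w)                  ≤⟨ right≤left+ℓ w ⟩
    left (path R w) ℤ.+ + ℓ           ≡⟨ cong (ℤ._+ + ℓ) (split-offset (xmin≤left w)) ⟩
    xmin ℤ.+ + offset w ℤ.+ + ℓ       ≡⟨ ℤ.+-assoc xmin (+ offset w) (+ ℓ) ⟩
    xmin ℤ.+ + (offset w ℕ.+ ℓ)       ∎)
    where open ℤ.≤-Reasoning

  layerOfPath : Fin n → ℕ
  layerOfPath u = layerIndex ℓ (mode R) n xmin (toℕ u) (path R u)

  close-layers : ∀ u w → Adj G u w → layerOfPath u ℕ.≤ suc (layerOfPath w)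
  close-layers u w adj
    with layerIndex-cases ℓ (mode R) n xmin (toℕ u) (path R u)
       | layerIndex-cases ℓ (mode R) n xmin (toℕ w) (path R w)
  ... | inj₁ (iso , _) | _ =
        contradiction (adjacent⇒share adj) (isolated⇒no-share (mode R) {path R u} {path R w} iso)
  ... | inj₂ _ | inj₁ (iso , _) =
        contradiction (adjacent⇒share (Graph.sym G adj)) (isolated⇒no-share (mode R) {path R w} {path R u} iso)
  ... | inj₂ (_ , eqᵤ) | inj₂ (_ , eq_w) rewrite eqᵤ | eq_w = begin
    n ℕ.+ offset u ℕ./ ℓ              ≤⟨ ℕ.+-monoʳ-≤ n (ℕ./-monoˡ-≤ ℓ (adjacent⇒offset≤ adj)) ⟩
    n ℕ.+ (offset w ℕ.+ ℓ) ℕ./ ℓ      ≡⟨ cong (n ℕ.+_) (ℕ.+-distrib-/-∣ʳ (offset w) ℕ.∣-refl) ⟩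
    n ℕ.+ (offset w ℕ./ ℓ ℕ.+ ℓ ℕ./ ℓ) ≡⟨ cong (λ q → n ℕ.+ (offset w ℕ./ ℓ ℕ.+ q)) (ℕ.n/n≡1 ℓ) ⟩
    n ℕ.+ (offset w ℕ./ ℓ ℕ.+ 1)      ≡⟨ cong (n ℕ.+_) (ℕ.+-comm _ 1) ⟩
    n ℕ.+ suc (offset w ℕ./ ℓ)        ≡⟨ ℕ.+-suc n _ ⟩
    suc (n ℕ.+ offset w ℕ./ ℓ)        ∎
    where open ℕ.≤-Reasoning

  -- The nodes are the possible ranks 0 to `n`. As `lo` is at least 1, bag 0 is empty; it keeps the
  -- tree nonempty when `n` is 0.
  decomposition : TreeDecomposition G
  decomposition = intervalDecomposition G n lo hi lo≤hi (λ v → rank≤n _) adjacent⇒lo≤hi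

  layering : Layering G
  layering = record { layerOf = layerOfPath ; close = close-layers }

  -- If the top of `w` were below the bottom of `u`, it would be at most that bottom minus 1, and
  -- the run of `w` would end before that of `u` starts. Passing to ranks thus creates no new
  -- intersections.
  runs-meet : ∀ {t : Fin (suc n)} {u w} → InRun G n lo hi u t → InRun G n lo hi w t →
    bottom (path R u) ℤ.≤ top (path R w)
  runs-meet {u = u} (lo≤t , _) (_ , t≤hi) = ℤ.≮⇒≥ λ t<b → ℕ.<-irrefl refl (ℕ.<-≤-trans lo≤t (ℕ.≤-trans t≤hi
    (rank-mono bottoms (ℤ.≤-trans (ℤ.i<j⇒i≤pred[j] t<b) (ℤ.≤-reflexive (ℤ.+-comm (ℤ.- + 1) (bottom (path R u))))))))

  slab-left : ∀ {u q} → offset u ℕ./ ℓ ≡ q → xmin ℤ.+ + (q ℕ.* ℓ) ℤ.≤ left (path R u)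
  slab-left {u} refl = ℤ.≤-trans (ℤ.+-monoʳ-≤ xmin (ℤ.+≤+ (ℕ.m/n*n≤m (offset u) ℓ)))
    (ℤ.≤-reflexive (sym (split-offset (xmin≤left u))))

  -- The left end lies strictly before column `(q + 1)ℓ` of the grid, so a length of at most `ℓ`
  -- keeps the right end strictly before `(q + 2)ℓ`. Strictness keeps the window at `2ℓ` columns.
  slab-right : ∀ {u q} → offset u ℕ./ ℓ ≡ q →
    right (path R u) ℤ.< xmin ℤ.+ + (q ℕ.* ℓ) ℤ.+ + (2 ℕ.* ℓ)
  slab-right {u} {q} refl = begin-strict
    right (path R u)                             ≤⟨ right≤left+ℓ u ⟩
    left (path R u) ℤ.+ + ℓ                      ≡⟨ cong (ℤ._+ + ℓ) (split-offset (xmin≤left u)) ⟩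
    xmin ℤ.+ + offset u ℤ.+ + ℓ                  ≡⟨ ℤ.+-assoc xmin (+ offset u) (+ ℓ) ⟩
    xmin ℤ.+ + (offset u ℕ.+ ℓ)                  <⟨ ℤ.+-monoʳ-< xmin (ℤ.+<+ (ℕ.+-monoˡ-< ℓ offset<)) ⟩
    xmin ℤ.+ + (q ℕ.* ℓ ℕ.+ ℓ ℕ.+ ℓ)             ≡⟨ cong (λ m → xmin ℤ.+ + m) (solve 2
      (λ a l → a :+ l :+ l := a :+ con 2 :* l) refl (q ℕ.* ℓ) ℓ) ⟩
    xmin ℤ.+ + (q ℕ.* ℓ ℕ.+ 2 ℕ.* ℓ)             ≡⟨ ℤ.+-assoc xmin (+ (q ℕ.* ℓ)) (+ (2 ℕ.* ℓ)) ⟨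
    xmin ℤ.+ + (q ℕ.* ℓ) ℤ.+ + (2 ℕ.* ℓ)         ∎
    where
    open ℤ.≤-Reasoning
    open +-*-Solver
    offset< : offset u ℕ.< offset u ℕ./ ℓ ℕ.* ℓ ℕ.+ ℓ
    offset< = ℕ.≤-trans (ℕ.≤-reflexive (cong suc (ℕ.m≡m%n+[m/n]*n (offset u) ℓ)))
      (ℕ.≤-trans (ℕ.+-monoˡ-≤ _ (ℕ.m%n<n (offset u) ℓ)) (ℕ.≤-reflexive (ℕ.+-comm ℓ _)))

  1≤bound : ∀ x → 1 ℕ.≤ bound x ℓ
  1≤bound vpg = ℕ.≤-trans 1≤ℓ (ℕ.m≤m+n ℓ _)
  1≤bound epg = ℕ.≤-trans 1≤ℓ (ℕ.≤-trans (ℕ.m≤n+m ℓ (5 ℕ.* 1 ∸ 1)) (ℕ.∸-monoˡ-≤ 1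
    (ℕ.≤-trans (ℕ.+-monoˡ-≤ ℓ (ℕ.*-monoʳ-≤ 5 1≤ℓ)) (ℕ.≤-reflexive (ℕ.+-comm (5 ℕ.* ℓ) ℓ)))))

  independent≤bound : ∀ t i I → IndependentIn G (bag decomposition t ∩ layer layering i) I →
    ∣ I ∣ ℕ.≤ bound (mode R) ℓ
  independent≤bound t i I (I⊆ , independent) with i ℕ.<? n
  -- A layer below `n` holds at most one vertex, the isolated one with that number, so a constant
  -- map is injective on `I`.
  ... | yes i<n = ℕ.≤-trans (injection⇒∣∣≤length I (tt ∷ []) (λ _ → tt) (λ _ → here refl)
          (λ u∈ w∈ _ → Fin.toℕ-injective (trans (index u∈) (sym (index w∈))))) (1≤bound (mode R))
    where
    index : ∀ {u} → u ∈ I → toℕ u ≡ i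
    index {u} u∈ with layerIndex-cases ℓ (mode R) n xmin (toℕ u) (path R u)
                    | ∈-tabulate⁻ (λ v → layerOfPath v ℕ.≟ i) (proj₂ (x∈p∩q⁻ _ _ (I⊆ u∈)))
    ... | inj₁ (_ , eq) | eq′ = trans (sym eq) eq′
    ... | inj₂ (_ , eq) | eq′ = contradiction i<n
          (ℕ.≤⇒≯ (ℕ.≤-trans (ℕ.m≤m+n n _) (ℕ.≤-reflexive (trans (sym eq) eq′))))
  ... | no i≮n = ℕ.≤-trans
      (injection⇒∣∣≤length I (resources (mode R) x₀ ℓ y) (proj₁ ∘ resource) (proj₁ ∘ proj₂ ∘ resource) distinct)
      (ℕ.≤-reflexive (length-resources (mode R) x₀ ℓ y 1≤ℓ))
    where
    x₀ : ℤ
    -- The left border of slab number `i - n`, where the window for the whole layer begins.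
    x₀ = xmin ℤ.+ + ((i ∸ n) ℕ.* ℓ)
    inRun : ∀ {u} → u ∈ I → InRun G n lo hi u t
    inRun u∈ = ∈-tabulate⁻ (inRun? G n lo hi t) (proj₁ (x∈p∩q⁻ _ _ (I⊆ u∈)))
    slab : ∀ {u} → u ∈ I → ¬ Isolated (mode R) (path R u) × offset u ℕ./ ℓ ≡ i ∸ n
    slab {u} u∈ with layerIndex-cases ℓ (mode R) n xmin (toℕ u) (path R u)
                   | ∈-tabulate⁻ (λ v → layerOfPath v ℕ.≟ i) (proj₂ (x∈p∩q⁻ _ _ (I⊆ u∈)))
    ... | inj₁ (_ , eq) | eq′ = contradiction (subst (ℕ._< n) (trans (sym eq) eq′) (Fin.toℕ<n u)) i≮n
    ... | inj₂ (¬iso , eq) | eq′ = ¬iso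
          , trans (sym (ℕ.m+n∸m≡n n _)) (cong (_∸ n) (trans (sym eq) eq′))
    height : ∃ λ y → ∀ {u} → u ∈ I → bottom (path R u) ℤ.≤ y × y ℤ.≤ top (path R u)
    height = common-height I (bottom ∘ path R) (top ∘ path R) (λ {u} {w} u∈ w∈ → runs-meet {t} {u} {w} (inRun u∈) (inRun w∈))
    y : ℤ
    y = proj₁ height
    resource : ∀ {u} (u∈ : u ∈ I) →
      ∃ λ r → r ∈ₗ resources (mode R) x₀ ℓ y × Uses (mode R) r (path R u)
    resource {u} u∈ = crossing-resource (mode R) (path R u) 1≤ℓ (proj₁ (slab u∈))
      (proj₁ (proj₂ height u∈)) (proj₂ (proj₂ height u∈))
      (slab-left (proj₂ (slab u∈))) (slab-right (proj₂ (slab u∈)))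
    distinct : ∀ {u w} (u∈ : u ∈ I) (w∈ : w ∈ I) →
      proj₁ (resource u∈) ≡ proj₁ (resource w∈) → u ≡ w
    distinct {u} {w} u∈ w∈ eq with u Fin.≟ w
    ... | yes u≡w = u≡w
    -- A common resource of two different vertices makes them adjacent, against independence.
    ... | no u≢w = contradiction
          (Equivalence.from (GridRepresentation.adjacent R u w u≢w)
            (uses⇒share (mode R) {path R u} {path R w} (proj₁ (resource u∈))
              (proj₂ (proj₂ (resource u∈)))
              (subst (λ r → Uses (mode R) r (path R w)) (sym eq) (proj₂ (proj₂ (resource w∈))))))
          (independent u w u∈ w∈)

  α-bag-layer≤bound : ∀ t i → α G (bag decomposition t ∩ layer layering i) ℕ.≤ bound (mode R) ℓ
  α-bag-layer≤bound t i = α≤ G _ (independent≤bound t i)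

-- Evaluation with cost bounds

total : List ℕ → ℕ
total []           = 0
total (c ∷ [])     = c
total (c ∷ d ∷ cs) = c ℕ.+ total (d ∷ cs)

total-∷ : ∀ c cs → total (c ∷ cs) ≡ c ℕ.+ total cs
total-∷ c []       = sym (ℕ.+-identityʳ c)
total-∷ c (d ∷ cs) = refl

total-++ : ∀ cs ds → total (cs ++ ds) ≡ total cs ℕ.+ total ds
total-++ []       ds = refl
total-++ (c ∷ cs) ds = trans (total-∷ c (cs ++ ds)) (trans (cong (c ℕ.+_) (total-++ cs ds))
  (trans (sym (ℕ.+-assoc c (total cs) (total ds))) (cong (ℕ._+ total ds) (sym (total-∷ c cs)))))

module Evaluation (P : Program) where
  open Program P
  open Semantics P

  -- The cost bound is split into a numeral a and a list s of symbolic summands,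
  -- so that the bound of a compound expression is computed by the type checker.
  record Eval {k} (ρ : Vec Val k) (e : Exp arity k) (v : Val) (a : ℕ) (s : List ℕ) : Set where
    constructor evaluates
    field
      {cost} : ℕ
      run    : ρ ⊢ e ⇓ v ∣ cost
      within : cost ℕ.≤ a ℕ.+ total s

  record Evals {k m} (ρ : Vec Val k) (es : Vec (Exp arity k) m) (vs : Vec Val m)
               (a : ℕ) (s : List ℕ) : Set where
    constructor evaluate
    field
      {cost} : ℕ
      run    : ρ ⊢* es ⇓ vs ∣ cost
      within : cost ℕ.≤ a ℕ.+ total s

  -- With numeral 0 and one summand the bound computes to `c` itself, since `total` adds no trailing
  -- zero.
  Run : ∀ {k} → Vec Val k → Exp arity k → Val → ℕ → Set
  Run ρ e v c = Eval ρ e v 0 (c ∷ [])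

  +-within : ∀ {c d a b} s t → c ℕ.≤ a ℕ.+ total s → d ℕ.≤ b ℕ.+ total t →
    c ℕ.+ d ℕ.≤ a ℕ.+ b ℕ.+ total (s ++ t)
  +-within {c} {d} {a} {b} s t c≤ d≤ = ℕ.≤-trans (ℕ.+-mono-≤ c≤ d≤) (ℕ.≤-reflexive
    (trans (solve 4 (λ a s b t → a :+ s :+ (b :+ t) := a :+ b :+ (s :+ t)) refl a (total s) b (total t))
      (cong (a ℕ.+ b ℕ.+_) (sym (total-++ s t)))))
    where open +-*-Solver

  close : ∀ {k} {ρ : Vec Val k} {e v a s c} → Eval ρ e v a s → a ℕ.+ total s ℕ.≤ c → Run ρ e v c
  close (evaluates r c≤) le = evaluates r (ℕ.≤-trans c≤ le)

  -- One iteration of a loop: the numeral and the summands s of its body, plus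
  -- the cost c of the remaining iterations.
  loop-step : ∀ {k} {ρ : Vec Val k} {e v a} K s c → Eval ρ e v a (s ++ c ∷ []) →
    {True (a ℕ.≤? K)} → Run ρ e v (K ℕ.+ total s ℕ.+ c)
  loop-step {a = a} K s c E {a≤K} = close E (ℕ.≤-trans
    (ℕ.+-mono-≤ (toWitness a≤K) (ℕ.≤-reflexive (total-++ s (c ∷ []))))
    (ℕ.≤-reflexive (sym (ℕ.+-assoc K (total s) c))))

  -- A base case costs only a numeral; `x` and `c` pad the bound to the shape of the loop's cost
  -- function.
  loop-end : ∀ {k} {ρ : Vec Val k} {e v a} K x c → Eval ρ e v a [] →
    {True (a ℕ.≤? K)} → Run ρ e v (K ℕ.+ x ℕ.+ c)
  loop-end {a = a} K x c E {a≤K} = close E (ℕ.≤-trans (ℕ.≤-reflexive (ℕ.+-identityʳ a))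
    (ℕ.≤-trans (toWitness a≤K) (ℕ.≤-trans (ℕ.m≤m+n K x) (ℕ.m≤m+n (K ℕ.+ x) c))))

  module _ {k} {ρ : Vec Val k} where

    varᵉ : ∀ {i} → Eval ρ (var i) (Vec.lookup ρ i) 1 []
    varᵉ = evaluates (var _) ℕ.≤-refl

    litᵉ : ∀ {z} → Eval ρ (lit z) (int z) 1 []
    litᵉ = evaluates (lit _) ℕ.≤-refl

    nilᵉ : Eval ρ nil nil 1 []
    nilᵉ = evaluates nil ℕ.≤-refl

    consᵉ : ∀ {e f v w a b s t} → Eval ρ e v a s → Eval ρ f w b t →
      Eval ρ (cons e f) (cons v w) (suc (a ℕ.+ b)) (s ++ t)
    consᵉ {s = s} {t} (evaluates r p) (evaluates r′ q) = evaluates (cons r r′) (s≤s (+-within s t p q))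

    addᵉ : ∀ {e f x y a b s t} → Eval ρ e (int x) a s → Eval ρ f (int y) b t →
      Eval ρ (add e f) (int (x ℤ.+ y)) (suc (a ℕ.+ b)) (s ++ t)
    addᵉ {s = s} {t} (evaluates r p) (evaluates r′ q) = evaluates (add r r′) (s≤s (+-within s t p q))

    subᵉ : ∀ {e f x y a b s t} → Eval ρ e (int x) a s → Eval ρ f (int y) b t →
      Eval ρ (sub e f) (int (x ℤ.- y)) (suc (a ℕ.+ b)) (s ++ t)
    subᵉ {s = s} {t} (evaluates r p) (evaluates r′ q) = evaluates (sub r r′) (s≤s (+-within s t p q))

    divᵉ : ∀ {q e x a s} .{{_ : NonZero q}} → Eval ρ e (int x) a s →
      Eval ρ (div q e) (int (x ℤ./ℕ q)) (suc a) s
    divᵉ (evaluates r p) = evaluates (div r) (s≤s p)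

    if-yesᵉ : ∀ {e f g h x y v a b c s t u} → x ℤ.≤ y →
      Eval ρ e (int x) a s → Eval ρ f (int y) b t → Eval ρ g v c u →
      Eval ρ (ifLeq e f g h) v (suc (a ℕ.+ b ℕ.+ c)) ((s ++ t) ++ u)
    if-yesᵉ {s = s} {t} {u} x≤y (evaluates r p) (evaluates r′ q) (evaluates r″ o) =
      evaluates (if-yes x≤y r r′ r″) (s≤s (+-within (s ++ t) u (+-within s t p q) o))

    if-noᵉ : ∀ {e f g h x y v a b c s t u} → y ℤ.< x →
      Eval ρ e (int x) a s → Eval ρ f (int y) b t → Eval ρ h v c u →
      Eval ρ (ifLeq e f g h) v (suc (a ℕ.+ b ℕ.+ c)) ((s ++ t) ++ u)
    if-noᵉ {s = s} {t} {u} y<x (evaluates r p) (evaluates r′ q) (evaluates r″ o) =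
      evaluates (if-no y<x r r′ r″) (s≤s (+-within (s ++ t) u (+-within s t p q) o))

    case-nilᵉ : ∀ {e f g v a b s t} → Eval ρ e nil a s → Eval ρ f v b t →
      Eval ρ (caseList e f g) v (suc (a ℕ.+ b)) (s ++ t)
    case-nilᵉ {s = s} {t} (evaluates r p) (evaluates r′ q) =
      evaluates (case-nil r r′) (s≤s (+-within s t p q))

    case-consᵉ : ∀ {e f g h l v a b s t} → Eval ρ e (cons h l) a s → Eval (h ∷ l ∷ ρ) g v b t →
      Eval ρ (caseList e f g) v (suc (a ℕ.+ b)) (s ++ t)
    case-consᵉ {s = s} {t} (evaluates r p) (evaluates r′ q) =
      evaluates (case-cons r r′) (s≤s (+-within s t p q))

    bindᵉ : ∀ {e f v w a b s t} → Eval ρ e v a s → Eval (v ∷ ρ) f w b t →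
      Eval ρ (bind e f) w (suc (a ℕ.+ b)) (s ++ t)
    bindᵉ {s = s} {t} (evaluates r p) (evaluates r′ q) = evaluates (bind r r′) (s≤s (+-within s t p q))

    callᵉ : ∀ {f es vs w a b s t} → Evals ρ es vs a s → Eval vs (body f) w b t →
      Eval ρ (call f es) w (suc (a ℕ.+ b)) (s ++ t)
    callᵉ {s = s} {t} (evaluate r p) (evaluates r′ q) = evaluates (call r r′) (s≤s (+-within s t p q))

    []ᵉ : Evals ρ [] [] 0 []
    []ᵉ = evaluate [] z≤n

    infixr 5 _∷ᵉ_
    _∷ᵉ_ : ∀ {m e v a b s t} {es : Vec (Exp arity k) m} {vs} → Eval ρ e v a s → Evals ρ es vs b t →
      Evals ρ (e ∷ es) (v ∷ vs) (a ℕ.+ b) (s ++ t)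
    _∷ᵉ_ {s = s} {t} (evaluates r p) (evaluate r′ q) = evaluate (r ∷ r′) (+-within s t p q)

    minᵉ : ∀ {e f x y} → Eval ρ e (int x) 1 [] → Eval ρ f (int y) 1 [] →
      Eval ρ (ifLeq e f e f) (int (x ℤ.⊓ y)) 4 []
    minᵉ {x = x} {y} E F with x ℤ.≤? y
    ... | yes x≤y rewrite ℤ.i≤j⇒i⊓j≡i x≤y = if-yesᵉ x≤y E F E
    ... | no x≰y rewrite ℤ.i≥j⇒i⊓j≡j (ℤ.<⇒≤ (ℤ.≰⇒> x≰y)) = if-noᵉ (ℤ.≰⇒> x≰y) E F F

    maxᵉ : ∀ {e f x y} → Eval ρ e (int x) 1 [] → Eval ρ f (int y) 1 [] →
      Eval ρ (ifLeq e f f e) (int (x ℤ.⊔ y)) 4 []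
    maxᵉ {x = x} {y} E F with x ℤ.≤? y
    ... | yes x≤y rewrite ℤ.i≤j⇒i⊔j≡j x≤y = if-yesᵉ x≤y E F F
    ... | no x≰y rewrite ℤ.i≥j⇒i⊔j≡i (ℤ.<⇒≤ (ℤ.≰⇒> x≰y)) = if-noᵉ (ℤ.≰⇒> x≰y) E F E

-- The program

arities : Vec ℕ 11
arities = 1 ∷ 1 ∷ 2 ∷ 3 ∷ 2 ∷ 2 ∷ 2 ∷ 2 ∷ 2 ∷ 1 ∷ 5 ∷ []

arityOf : Fin 11 → ℕ
arityOf = Vec.lookup arities

boxᶠ singlesᶠ mergeᶠ combineᶠ passᶠ reduceᶠ rankᶠ runsᶠ edgesᶠ lengthᶠ layersᶠ : Fin 11
boxᶠ     = # 0
singlesᶠ = # 1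
mergeᶠ   = # 2
combineᶠ = # 3
passᶠ    = # 4
reduceᶠ  = # 5
rankᶠ    = # 6
runsᶠ    = # 7
edgesᶠ   = # 8
lengthᶠ  = # 9
layersᶠ  = # 10

private
  E : ℕ → Set
  E = Exp arityOf

  v : ∀ i {k} {i<k : True (i ℕ.<? k)} → E k
  v i {i<k = i<k} = var (#_ i {m<n = i<k})

-- The comments list the variables in scope, innermost (index 0) first.
boxBody : E 1
boxBody =
  caseList (v 0) nil                             -- p ps′ ps
  (caseList (v 0) nil                            -- x y p ps′ ps
  (caseList (v 3) (cons (v 0) (cons (v 1) (v 1)))
                                                 -- q ps″ x y p ps′ ps
  (bind (call boxᶠ (v 5 ∷ []))                   -- rest q ps″ x y …
  (caseList (v 0) nil                            -- l bt rest q ps″ x y …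
  (caseList (v 1) nil                            -- b t l bt rest q ps″ x y …
  (cons (ifLeq (v 7) (v 2) (v 7) (v 2))
  (cons (ifLeq (v 8) (v 0) (v 8) (v 0))
        (ifLeq (v 8) (v 1) (v 1) (v 8)))))))))

singlesBody : E 1
singlesBody =
  caseList (v 0) nil                             -- P Ps …
  (cons (caseList (call boxᶠ (v 0 ∷ [])) nil     -- l bt …
        (caseList (v 1) nil                      -- b t …
        -- The entry 1 is the size of the one-node tree that this leaf will become.
        (cons (cons (v 0) (cons (lit (+ 1)) nil)) nil)))
        (call singlesᶠ (v 1 ∷ [])))

mergeBody : E 2
mergeBody =
  caseList (v 0) (v 1)                           -- x xs′ xs ys
  (caseList (v 3) (v 2)                          -- y ys′ x xs′ xs ys
  (caseList (v 0) nil                            -- b _ y ys′ x xs′ xs ys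
  (caseList (v 4) nil                            -- a _ b _ y ys′ x xs′ xs ys
  (ifLeq (v 0) (v 2)
    (cons (v 6) (call mergeᶠ (v 7 ∷ v 9 ∷ [])))
    (cons (v 4) (call mergeᶠ (v 8 ∷ v 5 ∷ [])))))))

-- With tag 0 the arguments are sorted lists of leaves, which are merged; with tag 1
-- they are trees, stored as their minimum, size and children, which are joined.
combineBody : E 3
combineBody =
  ifLeq (v 0) (lit (+ 0)) (call mergeᶠ (v 1 ∷ v 2 ∷ []))
  (caseList (v 1) nil                            -- m₁ r₁ tag a b
  (caseList (v 1) nil                            -- s₁ k₁ m₁ r₁ tag a b
  (caseList (v 6) nil                            -- m₂ r₂ s₁ k₁ m₁ r₁ tag a b
  (caseList (v 1) nil                            -- s₂ k₂ m₂ r₂ s₁ k₁ m₁ r₁ tag a b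
  (cons (v 6) (cons (add (v 4) (v 0)) (cons (v 9) (v 10))))))))

passBody : E 2
passBody =
  caseList (v 1) nil                             -- a as tag ls
  (caseList (v 1) (cons (v 0) nil)               -- b bs a as tag ls
  (cons (call combineᶠ (v 4 ∷ v 2 ∷ v 0 ∷ []))
        (call passᶠ (v 4 ∷ v 1 ∷ []))))

reduceBody : E 2
reduceBody =
  caseList (v 1) nil                             -- a as tag ls
  (caseList (v 1) (v 0)                          -- b bs a as tag ls
  (call reduceᶠ (v 4 ∷ call passᶠ (v 4 ∷ v 5 ∷ []) ∷ [])))

rankBody : E 2
rankBody =
  caseList (v 0) nil                             -- m r t y
  (caseList (v 1) nil                            -- s k m r t y
  (caseList (v 1) (ifLeq (v 2) (v 5) (lit (+ 1)) (lit (+ 0)))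
                                                 -- t₁ t₂ s k m r t y
  (caseList (v 1) nil                            -- m₂ r₂ t₁ t₂ s k m r t y
  (ifLeq (v 0) (v 9)
    (caseList (v 2) nil                          -- m₁ r₁ m₂ r₂ t₁ t₂ s k m r t y
    (caseList (v 1) nil                          -- s₁ k₁ m₁ r₁ m₂ r₂ t₁ t₂ s k m r t y
    (add (v 0) (call rankᶠ (v 7 ∷ v 13 ∷ [])))))
    (call rankᶠ (v 2 ∷ v 9 ∷ []))))))

runsBody : E 2
runsBody =
  caseList (v 1) nil                             -- P Ps tree paths
  (cons (caseList (call boxᶠ (v 0 ∷ [])) nil     -- l bt P Ps tree paths
        (caseList (v 1) nil                      -- b t l bt P Ps tree paths
        (cons (cons (add (lit (+ 1)) (call rankᶠ (v 6 ∷ sub (v 0) (lit (+ 1)) ∷ [])))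
                    (call rankᶠ (v 6 ∷ v 1 ∷ [])))
              nil)))
        (call runsᶠ (v 2 ∷ v 1 ∷ [])))

edgesBody : E 2
edgesBody =
  caseList (v 1) nil                             -- P Ps i paths
  (cons (cons (v 2) (add (lit (+ 1)) (v 2)))
        (call edgesᶠ (add (lit (+ 1)) (v 2) ∷ v 1 ∷ [])))

lengthBody : E 1
lengthBody =
  caseList (v 0) (lit (+ 0))                     -- P Ps paths
  (add (lit (+ 1)) (call lengthᶠ (v 1 ∷ [])))

levelBody : E 8
levelBody =                                      -- d P Ps n xmin mode i paths
  ifLeq (v 5) (lit (+ 0)) (v 0)
  (caseList (v 1) nil                            -- p ps d P Ps n xmin mode i paths
  (caseList (v 1) (v 8)                          -- q qs p ps d P Ps n xmin mode i paths
  (v 4)))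

layersBody : (ℓ : ℕ) .{{_ : NonZero ℓ}} → E 5
layersBody ℓ =
  caseList (v 4) nil                             -- P Ps n xmin mode i paths
  (cons (bind (caseList (call boxᶠ (v 0 ∷ [])) nil -- l bt P Ps n xmin mode i paths
              (add (v 4) (div ℓ (sub (v 0) (v 5)))))
        levelBody)
        (call layersᶠ (v 2 ∷ v 3 ∷ v 4 ∷ add (lit (+ 1)) (v 5) ∷ v 1 ∷ [])))

mainBody : E 1
mainBody =
  caseList (v 0) nil                             -- grid rest input
  (caseList (v 1) nil                            -- paths mode grid rest input
  (caseList (v 2) nil                            -- xmin _ paths mode grid rest input
  (bind (call lengthᶠ (v 2 ∷ []))                -- n xmin _ paths mode …
  (cons (add (lit (+ 1)) (v 0))
  (cons (call edgesᶠ (lit (+ 0) ∷ v 3 ∷ []))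
  (cons (call runsᶠ
          (call reduceᶠ (lit (+ 1) ∷
            call reduceᶠ (lit (+ 0) ∷ call singlesᶠ (v 3 ∷ []) ∷ []) ∷ []) ∷ v 3 ∷ []))
        (call layersᶠ (v 0 ∷ v 1 ∷ v 4 ∷ lit (+ 0) ∷ v 3 ∷ []))))))))

bodies : (ℓ : ℕ) .{{_ : NonZero ℓ}} → ∀ f → E (arityOf f)
bodies ℓ zero = boxBody
bodies ℓ (suc zero) = singlesBody
bodies ℓ (suc (suc zero)) = mergeBody
bodies ℓ (suc (suc (suc zero))) = combineBody
bodies ℓ (suc (suc (suc (suc zero)))) = passBody
bodies ℓ (suc (suc (suc (suc (suc zero))))) = reduceBody
bodies ℓ (suc (suc (suc (suc (suc (suc zero)))))) = rankBody
bodies ℓ (suc (suc (suc (suc (suc (suc (suc zero))))))) = runsBody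
bodies ℓ (suc (suc (suc (suc (suc (suc (suc (suc zero)))))))) = edgesBody
bodies ℓ (suc (suc (suc (suc (suc (suc (suc (suc (suc zero))))))))) = lengthBody
bodies ℓ (suc (suc (suc (suc (suc (suc (suc (suc (suc (suc zero)))))))))) = layersBody ℓ

program : (ℓ : ℕ) .{{_ : NonZero ℓ}} → Program
program ℓ = record { functions = 11 ; arity = arityOf ; body = bodies ℓ ; main = mainBody }

-- Search trees

data Tree : Set where
  leaf : ℤ → Tree
  join : Tree → Tree → Tree

minimum : Tree → ℤ
minimum (leaf b)   = b
minimum (join t _) = minimum t

size : Tree → ℕ
size (leaf _)   = 1
size (join t u) = size t ℕ.+ size u

depth : Tree → ℕ
depth (leaf _)   = 0
depth (join t u) = suc (depth t ℕ.⊔ depth u)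

inorder : Tree → List ℤ
inorder (leaf b)   = b ∷ []
inorder (join t u) = inorder t ++ inorder u

treeRank : Tree → ℤ → ℕ
treeRank (leaf b) y with b ℤ.≤? y
... | yes _ = 1
... | no _  = 0
treeRank (join t u) y with minimum u ℤ.≤? y
... | yes _ = size t ℕ.+ treeRank u y
... | no _  = treeRank t y

encodeLeaf : ℤ → Val
encodeLeaf b = cons (int b) (cons (int (+ 1)) nil)

encodeTree : Tree → Val
encodeTree (leaf b)       = encodeLeaf b
encodeTree t@(join t₁ t₂) =
  cons (int (minimum t)) (cons (int (+ size t)) (cons (encodeTree t₁) (encodeTree t₂)))

children : Tree → Val
children (leaf b)     = nil
children (join t₁ t₂) = cons (encodeTree t₁) (encodeTree t₂)

encodeTree-cons : ∀ t → encodeTree t ≡ cons (int (minimum t)) (cons (int (+ size t)) (children t))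
encodeTree-cons (leaf _)   = refl
encodeTree-cons (join _ _) = refl

AllPairs-++⁻ : ∀ {R : ℤ → ℤ → Set} xs {ys} → AllPairs R (xs ++ ys) →
  AllPairs R xs × AllPairs R ys × All (λ x → All (R x) ys) xs
AllPairs-++⁻ []       pys        = [] , pys , []
AllPairs-++⁻ (x ∷ xs) (px ∷ pxs) with AllPairs-++⁻ xs pxs | All.++⁻ xs px
... | pxs′ , pys , pxys | px₁ , px₂ = px₁ ∷ pxs′ , pys , px₂ ∷ pxys

rank-++ : ∀ xs ys y → rank (xs ++ ys) y ≡ rank xs y ℕ.+ rank ys y
rank-++ xs ys y = trans (cong length (List.filter-++ (ℤ._≤? y) xs ys))
  (List.length-++ (List.filter (ℤ._≤? y) xs))

inorder-minimum : ∀ t → ∃ λ bs → inorder t ≡ minimum t ∷ bs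
inorder-minimum (leaf b) = [] , refl
inorder-minimum (join t u) with inorder-minimum t
... | bs , eq = bs ++ inorder u , cong (_++ inorder u) eq

length-inorder : ∀ t → length (inorder t) ≡ size t
length-inorder (leaf b)   = refl
length-inorder (join t u) = trans (List.length-++ (inorder t))
  (cong₂ ℕ._+_ (length-inorder t) (length-inorder u))

minimum-least : ∀ t → AllPairs ℤ._≤_ (inorder t) → All (minimum t ℤ.≤_) (inorder t)
minimum-least t sorted with inorder t | inorder-minimum t
minimum-least t (m≤ ∷ _) | _ | bs , refl = ℤ.≤-refl ∷ m≤

-- If the minimum of the right subtree is at most `y`, sortedness makes the whole left subtree
-- count; otherwise nothing on the right counts. Hence one descent per level is enough.
treeRank≡rank : ∀ t y → AllPairs ℤ._≤_ (inorder t) → treeRank t y ≡ rank (inorder t) y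
treeRank≡rank (leaf b) y _ with b ℤ.≤? y
... | yes _ = refl
... | no _  = refl
treeRank≡rank (join t u) y sorted with AllPairs-++⁻ (inorder t) sorted
... | sortedₜ , sortedᵤ , t≤u with minimum u ℤ.≤? y
...   | yes m≤y = sym (trans (rank-++ (inorder t) (inorder u) y) (cong₂ ℕ._+_
          (trans (cong length (List.filter-all (ℤ._≤? y) (All.map bounded t≤u))) (length-inorder t))
          (sym (treeRank≡rank u y sortedᵤ))))
        where
        bounded : ∀ {b} → All (b ℤ.≤_) (inorder u) → b ℤ.≤ y
        bounded b≤ with inorder u | inorder-minimum u
        bounded (b≤m ∷ _) | _ | _ , refl = ℤ.≤-trans b≤m m≤y
...   | no m≰y = sym (trans (rank-++ (inorder t) (inorder u) y)
        (trans (cong (rank (inorder t) y ℕ.+_) (cong length (List.filter-none (ℤ._≤? y)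
          (All.map (λ m≤b b≤y → m≰y (ℤ.≤-trans m≤b b≤y)) (minimum-least u sortedᵤ)))))
        (trans (ℕ.+-identityʳ _) (sym (treeRank≡rank t y sortedₜ)))))

rank-↭ : ∀ {xs ys} y → xs ↭ ys → rank xs y ≡ rank ys y
rank-↭ y p = ↭-length (filter-↭ (ℤ._≤? y) p)

-- Pairwise passes over a list

pass : ∀ {A : Set} → (A → A → A) → List A → List A
pass _⊕_ []           = []
pass _⊕_ (a ∷ [])     = a ∷ []
pass _⊕_ (a ∷ b ∷ as) = a ⊕ b ∷ pass _⊕_ as

length-pass : ∀ {A : Set} (_⊕_ : A → A → A) m as → length as ℕ.≤ m ℕ.+ m → length (pass _⊕_ as) ℕ.≤ m
length-pass _⊕_ m       []           _ = z≤n
length-pass _⊕_ (suc m) (a ∷ [])     _ = s≤s z≤n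
length-pass _⊕_ (suc m) (a ∷ b ∷ as) (s≤s le) = s≤s (length-pass _⊕_ m as
  (ℕ.≤-pred (ℕ.≤-trans le (ℕ.≤-reflexive (ℕ.+-suc m m)))))

weight : ∀ {A : Set} → (A → ℕ) → List A → ℕ
weight w = sum ∘ List.map w

-- Used to charge every pass to the weight of the initial list, however many passes came before.
weight-pass : ∀ {A : Set} (w : A → ℕ) (_⊕_ : A → A → A) → (∀ a b → w (a ⊕ b) ℕ.≤ w a ℕ.+ w b) →
  ∀ as → weight w (pass _⊕_ as) ℕ.≤ weight w as
weight-pass w _⊕_ w-⊕ []           = z≤n
weight-pass w _⊕_ w-⊕ (a ∷ [])     = ℕ.≤-refl
weight-pass w _⊕_ w-⊕ (a ∷ b ∷ as) = ℕ.≤-trans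
  (ℕ.+-mono-≤ (w-⊕ a b) (weight-pass w _⊕_ w-⊕ as)) (ℕ.≤-reflexive (ℕ.+-assoc (w a) (w b) _))

-- Correctness and running time of the program

-- The numerals in these functions are round caps rather than exact counts; `loop-step` and
-- `loop-end` check by decision that the computed numerals stay below the caps they are given.
lengthCost edgesCost : ℕ → ℕ
lengthCost n = suc n ℕ.* 20
edgesCost  n = suc n ℕ.* 20

boxCost : ℕ → ℕ
boxCost m = m ℕ.* 60

mergeCost : ℕ → ℕ
mergeCost m = suc m ℕ.* 40

singlesCost layersCost : ℕ → ℕ → ℕ
singlesCost m n = suc n ℕ.* (40 ℕ.+ boxCost m)
layersCost  m n = suc n ℕ.* (70 ℕ.+ boxCost m)

rankCost : ℕ → ℕ
rankCost d = suc d ℕ.* 40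

runsCost : ℕ → ℕ → ℕ → ℕ
runsCost m r n = suc n ℕ.* (50 ℕ.+ (boxCost m ℕ.+ (r ℕ.+ r)))

passCost : ℕ → ℕ
passCost W = suc W ℕ.* 80

reduceCost : ℕ → ℕ → ℕ
reduceCost L W = suc L ℕ.* (30 ℕ.+ passCost W)

-- The order is that of the calls in `mainBody`, so that the list agrees definitionally with the
-- summands collected by the derivation. The two reductions are sorting, of weight `2n`, and tree
-- building, of weight `n`.
stageCosts : ℕ → ℕ → ℕ → List ℕ
stageCosts m L n = lengthCost n ∷ edgesCost n ∷ singlesCost m n ∷ reduceCost L (n ℕ.* 2) ∷
  reduceCost L n ∷ runsCost m (rankCost L) n ∷ []

runningTime : ℕ → ℕ → ℕ → ℕ
runningTime m L n = 100 ℕ.+ total (stageCosts m L n) ℕ.+ layersCost m n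

module Correctness (ℓ : ℕ) {{ℓ≢0 : NonZero ℓ}} where

  open Evaluation (program ℓ)

  Call : ∀ f → Vec Val (arityOf f) → Val → ℕ → Set
  Call f vs v c = Run vs (bodies ℓ f) v c

  boxOf : List⁺ Point → Val
  boxOf ps = cons (int (lowest proj₁ ps)) (cons (int (lowest proj₂ ps)) (int (highest proj₂ ps)))

  box-corners : ∀ p ps → Call boxᶠ (encodeList (encodePair int) (p ∷ ps) ∷ [])
    (boxOf (p ∷ ps)) (boxCost (suc (length ps)))
  box-corners p [] = loop-end 60 0 0
    (case-consᵉ varᵉ (case-consᵉ varᵉ (case-nilᵉ varᵉ (consᵉ varᵉ (consᵉ varᵉ varᵉ)))))
  box-corners p (q ∷ ps) = loop-step 60 [] (boxCost (suc (length ps)))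
    (case-consᵉ varᵉ (case-consᵉ varᵉ (case-consᵉ varᵉ
      (bindᵉ (callᵉ (varᵉ ∷ᵉ []ᵉ) (box-corners q ps))
      (case-consᵉ varᵉ (case-consᵉ varᵉ
      (consᵉ (minᵉ varᵉ varᵉ) (consᵉ (minᵉ varᵉ varᵉ) (maxᵉ varᵉ varᵉ)))))))))

  Corners≤ : ℕ → GridPath → Set
  Corners≤ m P = length (toList (corners P)) ℕ.≤ m

  box : ∀ {m} P → Corners≤ m P → Call boxᶠ (encodePath P ∷ []) (boxOf (corners P)) (boxCost m)
  box P ≤m with corners P
  ... | p ∷ ps = close (box-corners p ps) (ℕ.*-monoˡ-≤ 60 ≤m)

  encodeLeaves : List ℤ → Val
  encodeLeaves = encodeList encodeLeaf

  singles : ∀ {m} Ps → All (Corners≤ m) Ps → Call singlesᶠ (encodeList encodePath Ps ∷ [])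
    (encodeList encodeLeaves (List.map (λ P → bottom P ∷ []) Ps)) (singlesCost m (length Ps))
  singles {m} [] _ = loop-end 40 (boxCost m) 0 (case-nilᵉ varᵉ nilᵉ)
  singles {m} (P ∷ Ps) (≤m ∷ ≤ms) = loop-step 40 (boxCost m ∷ []) (singlesCost m (length Ps))
    (case-consᵉ varᵉ (consᵉ
      (case-consᵉ (callᵉ (varᵉ ∷ᵉ []ᵉ) (box P ≤m)) (case-consᵉ varᵉ
        (consᵉ (consᵉ varᵉ (consᵉ litᵉ nilᵉ)) nilᵉ)))
      (callᵉ (varᵉ ∷ᵉ []ᵉ) (singles Ps ≤ms))))

  merge : ∀ xs ys → Call mergeᶠ (encodeLeaves xs ∷ encodeLeaves ys ∷ [])
    (encodeLeaves (List.merge ℤ._≤?_ xs ys)) (mergeCost (length xs ℕ.+ length ys))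
  merge [] ys = loop-end 40 0 (length ys ℕ.* 40) (case-nilᵉ varᵉ varᵉ)
  merge (x ∷ xs) [] = loop-end 40 0 ((length (x ∷ xs) ℕ.+ 0) ℕ.* 40)
    (case-consᵉ varᵉ (case-nilᵉ varᵉ varᵉ))
  merge (x ∷ xs) (y ∷ ys) with x ℤ.≤? y | merge xs (y ∷ ys) | merge (x ∷ xs) ys
  ... | yes x≤y | rec | _ = loop-step 40 [] (mergeCost (length xs ℕ.+ length (y ∷ ys)))
    (case-consᵉ varᵉ (case-consᵉ varᵉ (case-consᵉ varᵉ (case-consᵉ varᵉ
      (if-yesᵉ x≤y varᵉ varᵉ (consᵉ varᵉ (callᵉ (varᵉ ∷ᵉ varᵉ ∷ᵉ []ᵉ) rec)))))))
  ... | no x≰y | _ | rec rewrite ℕ.+-suc (length xs) (length ys) =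
    loop-step 40 [] (mergeCost (length (x ∷ xs) ℕ.+ length ys))
    (case-consᵉ varᵉ (case-consᵉ varᵉ (case-consᵉ varᵉ (case-consᵉ varᵉ
      (if-noᵉ (ℤ.≰⇒> x≰y) varᵉ varᵉ (consᵉ varᵉ (callᵉ (varᵉ ∷ᵉ varᵉ ∷ᵉ []ᵉ) rec)))))))

  combine-merge : ∀ xs ys → Call combineᶠ (int (+ 0) ∷ encodeLeaves xs ∷ encodeLeaves ys ∷ [])
    (encodeLeaves (List.merge ℤ._≤?_ xs ys)) (20 ℕ.+ mergeCost (length xs ℕ.+ length ys))
  combine-merge xs ys = loop-step 20 [] (mergeCost (length xs ℕ.+ length ys))
    (if-yesᵉ ℤ.≤-refl varᵉ litᵉ (callᵉ (varᵉ ∷ᵉ varᵉ ∷ᵉ []ᵉ) (merge xs ys)))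

  -- `encodeTree t` is stuck on a variable `t`; rewriting exposes the cells that `case-consᵉ` needs.
  viewTree : ∀ t {k} {ρ : Vec Val k} {e a s} → Eval ρ e (encodeTree t) a s →
    Eval ρ e (cons (int (minimum t)) (cons (int (+ size t)) (children t))) a s
  viewTree t E rewrite encodeTree-cons t = E

  combine-join : ∀ t u → Call combineᶠ (int (+ 1) ∷ encodeTree t ∷ encodeTree u ∷ [])
    (encodeTree (join t u)) 40
  combine-join t u = loop-end 40 0 0
    (if-noᵉ (ℤ.+<+ (s≤s z≤n)) varᵉ litᵉ
      (case-consᵉ (viewTree t varᵉ) (case-consᵉ varᵉ (case-consᵉ (viewTree u varᵉ) (case-consᵉ varᵉ
        (consᵉ varᵉ (consᵉ (addᵉ varᵉ varᵉ) (consᵉ varᵉ varᵉ))))))))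

  -- Reduction by passes, shared by sorting and tree building

  module Reduction {A : Set} (enc : A → Val) (tag : ℤ) (_⊕_ : A → A → A) (w : A → ℕ)
    (w-⊕ : ∀ a b → w (a ⊕ b) ℕ.≤ w a ℕ.+ w b)
    (combine : ∀ a b → ∃ λ c → Call combineᶠ (int tag ∷ enc a ∷ enc b ∷ []) (enc (a ⊕ b)) c ×
                               20 ℕ.+ c ℕ.≤ (w a ℕ.+ w b) ℕ.* 80) where

    -- Each combination is paid by the weights of its two arguments at rate 80, so a pass is linear
    -- in the total weight.
    pass-run : ∀ as → Call passᶠ (int tag ∷ encodeList enc as ∷ [])
      (encodeList enc (pass _⊕_ as)) (passCost (weight w as))
    pass-run []       = loop-end 80 0 0 (case-nilᵉ varᵉ nilᵉ)
    pass-run (a ∷ []) = loop-end 80 0 (weight w (a ∷ []) ℕ.* 80)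
      (case-consᵉ varᵉ (case-nilᵉ varᵉ (consᵉ varᵉ nilᵉ)))
    pass-run (a ∷ b ∷ as) with combine a b
    ... | c , combined , c≤ = close
      (loop-step 20 (c ∷ []) (passCost (weight w as))
        (case-consᵉ varᵉ (case-consᵉ varᵉ
          (consᵉ (callᵉ (varᵉ ∷ᵉ varᵉ ∷ᵉ varᵉ ∷ᵉ []ᵉ) combined)
                 (callᵉ (varᵉ ∷ᵉ varᵉ ∷ᵉ []ᵉ) (pass-run as))))))
      (begin
        20 ℕ.+ c ℕ.+ passCost W                        ≤⟨ ℕ.+-monoˡ-≤ (passCost W) c≤ ⟩
        (w a ℕ.+ w b) ℕ.* 80 ℕ.+ passCost W            ≡⟨ ℕ.*-distribʳ-+ 80 (w a ℕ.+ w b) (suc W) ⟨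
        (w a ℕ.+ w b ℕ.+ suc W) ℕ.* 80                 ≡⟨ cong (ℕ._* 80) {w a ℕ.+ w b ℕ.+ suc W} {suc (w a ℕ.+ (w b ℕ.+ W))}
                                                            (trans (ℕ.+-suc (w a ℕ.+ w b) W)
                                                              (cong suc (ℕ.+-assoc (w a) (w b) W))) ⟩
        passCost (w a ℕ.+ (w b ℕ.+ W))                 ∎)
      where
      open ℕ.≤-Reasoning
      W = weight w as

    module _ (I : ℕ → List A → Set) (I-pass : ∀ {d} as → I d as → I (suc d) (pass _⊕_ as)) where

      -- Each pass halves the length, rounding up, so `L` passes suffice, and the weight never
      -- exceeds `W`. The index of the invariant `I` counts passes, which later bounds the depth of
      -- the tree.
      reduce-run : ∀ L W {d} a as → length (a ∷ as) ℕ.≤ 2 ℕ.^ L → weight w (a ∷ as) ℕ.≤ W → I d (a ∷ as) →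
        ∃ λ r → Call reduceᶠ (int tag ∷ encodeList enc (a ∷ as) ∷ []) (enc r) (reduceCost L W) ×
        ∃ λ d′ → d′ ℕ.≤ L ℕ.+ d × I d′ (r ∷ [])
      reduce-run L W a [] _ _ inv =
        a , loop-end 30 (passCost W) (L ℕ.* (30 ℕ.+ passCost W)) (case-consᵉ varᵉ (case-nilᵉ varᵉ varᵉ))
          , _ , ℕ.m≤n+m _ L , inv
      reduce-run zero W a (b ∷ as) (s≤s ()) _ _
      reduce-run (suc L) W {d} a (b ∷ as) len≤ weight≤ inv
        with reduce-run L W (a ⊕ b) (pass _⊕_ as)
               (length-pass _⊕_ (2 ℕ.^ L) (a ∷ b ∷ as)
                 (ℕ.≤-trans len≤ (ℕ.≤-reflexive (cong (2 ℕ.^ L ℕ.+_) (ℕ.+-identityʳ _)))))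
               (ℕ.≤-trans (weight-pass w _⊕_ w-⊕ (a ∷ b ∷ as)) weight≤)
               (I-pass (a ∷ b ∷ as) inv)
      ... | r , reduced , d′ , d′≤ , inv′ =
        r , loop-step 30 (passCost W ∷ []) (reduceCost L W)
              (case-consᵉ varᵉ (case-consᵉ varᵉ (callᵉ
                (varᵉ ∷ᵉ callᵉ (varᵉ ∷ᵉ varᵉ ∷ᵉ []ᵉ)
                  (close (pass-run (a ∷ b ∷ as)) (ℕ.*-monoˡ-≤ 80 (s≤s weight≤))) ∷ᵉ []ᵉ)
                reduced)))
          , d′ , ℕ.≤-trans d′≤ (ℕ.≤-reflexive (ℕ.+-suc L d)) , inv′

  -- Weighting a list by one more than its length leaves enough for the constant overhead even when
  -- both lists are empty.
  merge-cost : ∀ a b → 20 ℕ.+ (20 ℕ.+ mergeCost (a ℕ.+ b)) ℕ.≤ (suc a ℕ.+ suc b) ℕ.* 80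
  merge-cost a b = ℕ.≤-trans (ℕ.m≤m+n _ (40 ℕ.* (2 ℕ.+ (a ℕ.+ b)))) (ℕ.≤-reflexive
    (solve 2 (λ a b → con 20 :+ (con 20 :+ (con 1 :+ (a :+ b)) :* con 40) :+ con 40 :* (con 2 :+ (a :+ b))
                   := (con 1 :+ a :+ (con 1 :+ b)) :* con 80) refl a b))
    where open +-*-Solver

  module Sorting = Reduction encodeLeaves (+ 0) (List.merge ℤ._≤?_) (suc ∘ length)
    (λ xs ys → s≤s (ℕ.≤-trans
      (ℕ.≤-reflexive (trans (↭-length (merge-↭ ℤ._≤?_ xs ys)) (List.length-++ xs)))
      (ℕ.+-monoʳ-≤ (length xs) (ℕ.n≤1+n _))))
    (λ xs ys → _ , combine-merge xs ys , merge-cost (length xs) (length ys))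

  SortedParts : List ℤ → ℕ → List (List ℤ) → Set
  SortedParts bs _ ls = All Sorted ls × List.concat ls ↭ bs

  sortedParts-pass : ∀ {bs d} ls → SortedParts bs d ls → SortedParts bs (suc d) (pass (List.merge ℤ._≤?_) ls)
  sortedParts-pass ls (sorted , perm) = pass-sorted ls sorted , ↭-trans (pass-↭ ls) perm
    where
    pass-sorted : ∀ ls → All Sorted ls → All Sorted (pass (List.merge ℤ._≤?_) ls)
    pass-sorted []            []             = []
    pass-sorted (xs ∷ [])     (s ∷ [])       = s ∷ []
    pass-sorted (xs ∷ ys ∷ ls) (s ∷ s′ ∷ ss) = merge⁺ ℤ.≤-decTotalOrder s s′ ∷ pass-sorted ls ss
    pass-↭ : ∀ ls → List.concat (pass (List.merge ℤ._≤?_) ls) ↭ List.concat ls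
    pass-↭ []             = ↭-refl
    pass-↭ (xs ∷ [])      = ↭-refl
    pass-↭ (xs ∷ ys ∷ ls) = ↭-trans (++⁺ (merge-↭ ℤ._≤?_ xs ys) (pass-↭ ls))
      (↭-reflexive (List.++-assoc xs ys (List.concat ls)))

  module Building = Reduction encodeTree (+ 1) join (λ _ → 1) (λ _ _ → s≤s z≤n)
    (λ t u → _ , combine-join t u , ℕ.m≤m+n 60 100)

  -- Joining neighbours keeps the inorder sequence and adds at most one level per pass; this yields
  -- the logarithmic depth.
  Forest : List ℤ → ℕ → List Tree → Set
  Forest bs d ts = All (λ t → depth t ℕ.≤ d) ts × List.concatMap inorder ts ≡ bs

  forest-pass : ∀ {bs d} ts → Forest bs d ts → Forest bs (suc d) (pass join ts)
  forest-pass ts (depth≤ , refl) = pass-depth ts depth≤ , pass-inorder ts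
    where
    pass-depth : ∀ {d} ts → All (λ t → depth t ℕ.≤ d) ts → All (λ t → depth t ℕ.≤ suc d) (pass join ts)
    pass-depth []           []             = []
    pass-depth (t ∷ [])     (p ∷ [])       = ℕ.m≤n⇒m≤1+n p ∷ []
    pass-depth (t ∷ u ∷ ts) (p ∷ q ∷ ps)   = s≤s (ℕ.⊔-lub p q) ∷ pass-depth ts ps
    pass-inorder : ∀ ts → List.concatMap inorder (pass join ts) ≡ List.concatMap inorder ts
    pass-inorder []           = refl
    pass-inorder (t ∷ [])     = refl
    pass-inorder (t ∷ u ∷ ts) = trans (List.++-assoc (inorder t) (inorder u) _)
      (cong (λ bs → inorder t ++ inorder u ++ bs) (pass-inorder ts))

  -- Rank queries and the index that answers them

  rank-run : ∀ t y d → depth t ℕ.≤ d →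
    Call rankᶠ (encodeTree t ∷ int y ∷ []) (int (+ treeRank t y)) (rankCost d)
  rank-run (leaf b) y d _ with b ℤ.≤? y
  ... | yes b≤y = loop-end 40 0 (d ℕ.* 40)
        (case-consᵉ varᵉ (case-consᵉ varᵉ (case-nilᵉ varᵉ (if-yesᵉ b≤y varᵉ varᵉ litᵉ))))
  ... | no b≰y = loop-end 40 0 (d ℕ.* 40)
        (case-consᵉ varᵉ (case-consᵉ varᵉ (case-nilᵉ varᵉ (if-noᵉ (ℤ.≰⇒> b≰y) varᵉ varᵉ litᵉ))))
  rank-run (join t u) y (suc d) (s≤s le) with minimum u ℤ.≤? y
  ... | yes m≤y = loop-step 40 [] (rankCost d)
        (case-consᵉ varᵉ (case-consᵉ varᵉ (case-consᵉ varᵉ (case-consᵉ (viewTree u varᵉ)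
          (if-yesᵉ m≤y varᵉ varᵉ (case-consᵉ (viewTree t varᵉ) (case-consᵉ varᵉ
            (addᵉ varᵉ (callᵉ (varᵉ ∷ᵉ varᵉ ∷ᵉ []ᵉ)
              (rank-run u y d (ℕ.≤-trans (ℕ.m≤n⊔m _ _) le)))))))))))
  ... | no m≰y = loop-step 40 [] (rankCost d)
        (case-consᵉ varᵉ (case-consᵉ varᵉ (case-consᵉ varᵉ (case-consᵉ (viewTree u varᵉ)
          (if-noᵉ (ℤ.≰⇒> m≰y) varᵉ varᵉ (callᵉ (varᵉ ∷ᵉ varᵉ ∷ᵉ []ᵉ)
            (rank-run t y d (ℕ.≤-trans (ℕ.m≤m⊔n _ _) le))))))))

  -- Sorted leaves and one-node trees have the same encoding, so the output of sorting is fed to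
  -- tree building unchanged.
  encode-leaves : ∀ bs → encodeList encodeTree (List.map leaf bs) ≡ encodeLeaves bs
  encode-leaves []       = refl
  encode-leaves (b ∷ bs) = cong (cons (encodeLeaf b)) (encode-leaves bs)

  concatMap-leaves : ∀ bs → List.concatMap inorder (List.map leaf bs) ≡ bs
  concatMap-leaves []       = refl
  concatMap-leaves (b ∷ bs) = cong (b ∷_) (concatMap-leaves bs)

  weight-leaves : ∀ bs → weight (λ _ → 1) (List.map leaf bs) ≡ length bs
  weight-leaves []       = refl
  weight-leaves (b ∷ bs) = cong suc (weight-leaves bs)

  build-run : ∀ L n bs → Sorted bs → 1 ℕ.≤ length bs → length bs ℕ.≤ n → n ℕ.≤ 2 ℕ.^ L →
    ∃ λ t → Call reduceᶠ (int (+ 1) ∷ encodeLeaves bs ∷ []) (encodeTree t) (reduceCost L n) ×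
    (∀ y → Call rankᶠ (encodeTree t ∷ int y ∷ []) (int (+ rank bs y)) (rankCost L))
  build-run L n bs@(b ∷ bs′) sorted _ ≤n n≤ with Building.reduce-run (Forest bs) forest-pass L n {0}
      (leaf b) (List.map leaf bs′)
      (ℕ.≤-trans (ℕ.≤-reflexive (List.length-map leaf bs)) (ℕ.≤-trans ≤n n≤))
      (ℕ.≤-trans (ℕ.≤-reflexive (weight-leaves bs)) ≤n)
      (All.map⁺ (All.universal (λ _ → z≤n) bs) , concatMap-leaves bs)
  ... | t , built , d , d≤ , (depth≤ ∷ []) , inorder≡ = t
      , subst (λ leaves → Call reduceᶠ (int (+ 1) ∷ leaves ∷ []) (encodeTree t) (reduceCost L n))
          (encode-leaves bs) built
      , λ y → subst (λ r → Call rankᶠ (encodeTree t ∷ int y ∷ []) (int (+ r)) (rankCost L))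
          (ranks y) (rank-run t y L (ℕ.≤-trans depth≤ (ℕ.≤-trans d≤ (ℕ.≤-reflexive (ℕ.+-identityʳ L)))))
      where
      inorder-t : inorder t ≡ bs
      inorder-t = trans (sym (List.++-identityʳ (inorder t))) inorder≡
      ranks : ∀ y → treeRank t y ≡ rank bs y
      ranks y = trans (treeRank≡rank t y (subst (AllPairs ℤ._≤_) (sym inorder-t)
        (Linked⇒AllPairs ℤ.≤-trans sorted))) (cong (λ bs → rank bs y) inorder-t)

  singletons : List GridPath → List (List ℤ)
  singletons = List.map (λ P → bottom P ∷ [])

  concat-singletons : ∀ Ps → List.concat (singletons Ps) ≡ List.map bottom Ps
  concat-singletons []       = refl
  concat-singletons (P ∷ Ps) = cong (bottom P ∷_) (concat-singletons Ps)

  weight-singletons : ∀ Ps → weight (suc ∘ length) (singletons Ps) ≡ length Ps ℕ.* 2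
  weight-singletons []       = refl
  weight-singletons (P ∷ Ps) = cong (2 ℕ.+_) (weight-singletons Ps)

  sort-run : ∀ L P Ps → length (P ∷ Ps) ℕ.≤ 2 ℕ.^ L → ∃ λ bs →
    Call reduceᶠ (int (+ 0) ∷ encodeList encodeLeaves (singletons (P ∷ Ps)) ∷ []) (encodeLeaves bs)
      (reduceCost L (length (P ∷ Ps) ℕ.* 2)) ×
    Sorted bs × bs ↭ List.map bottom (P ∷ Ps)
  sort-run L P Ps len≤ =
    let bs , sorts , _ , _ , sorted , perm =
          Sorting.reduce-run (SortedParts (List.map bottom (P ∷ Ps)))
            (λ {d} → sortedParts-pass {d = d})
            L (length (P ∷ Ps) ℕ.* 2) {0} (bottom P ∷ []) (singletons Ps)
            (ℕ.≤-trans (ℕ.≤-reflexive (List.length-map (λ P → bottom P ∷ []) (P ∷ Ps))) len≤)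
            (ℕ.≤-reflexive (weight-singletons (P ∷ Ps)))
            (All.map⁺ (All.universal (λ _ → [-]) (P ∷ Ps)) , ↭-reflexive (concat-singletons (P ∷ Ps)))
    in bs , sorts , All.head sorted , ↭-trans (↭-reflexive (sym (List.++-identityʳ bs))) perm

  -- For `n ≡ 0` the reduction returns `nil`, which encodes no tree, and no query will be asked.
  Index : ℕ → ℕ → Val → Val → (ℤ → ℕ) → Set
  Index L n sorted tree rk =
    Call reduceᶠ (int (+ 1) ∷ sorted ∷ []) tree (reduceCost L n) ×
    (n ≡ 0 ⊎ ∀ y → Call rankᶠ (tree ∷ int y ∷ []) (int (+ rk y)) (rankCost L))

  index-run : ∀ L Ps → length Ps ℕ.≤ 2 ℕ.^ L → ∃₂ λ sorted tree →
    Call reduceᶠ (int (+ 0) ∷ encodeList encodeLeaves (singletons Ps) ∷ []) sorted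
      (reduceCost L (length Ps ℕ.* 2)) ×
    Index L (length Ps) sorted tree (rank (List.map bottom Ps))
  index-run L [] _ = nil , nil
    , loop-end 30 (passCost 0) (L ℕ.* (30 ℕ.+ passCost 0)) (case-nilᵉ varᵉ nilᵉ)
    , loop-end 30 (passCost 0) (L ℕ.* (30 ℕ.+ passCost 0)) (case-nilᵉ varᵉ nilᵉ)
    , inj₁ refl
  index-run L (P ∷ Ps) len≤ =
    let bs , sorts , sorted , perm = sort-run L P Ps len≤
        length-bs = trans (↭-length perm) (List.length-map bottom (P ∷ Ps))
        t , built , ranks = build-run L (length (P ∷ Ps)) bs sorted
          (ℕ.≤-trans (s≤s z≤n) (ℕ.≤-reflexive (sym length-bs))) (ℕ.≤-reflexive length-bs) len≤
    in encodeLeaves bs , encodeTree t , sorts , built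
      , inj₂ λ y → subst (λ r → Call rankᶠ (encodeTree t ∷ int y ∷ []) (int (+ r)) (rankCost L))
          (rank-↭ y perm) (ranks y)

  -- Runs, edges and layers of the output

  runOf : List ℤ → GridPath → List (ℕ × ℕ)
  runOf bs P = (suc (rank bs (bottom P ℤ.- + 1)) , rank bs (top P)) ∷ []

  runs-run : ∀ {m tree r} bs Ps → All (Corners≤ m) Ps →
    length Ps ≡ 0 ⊎ (∀ y → Call rankᶠ (tree ∷ int y ∷ []) (int (+ rank bs y)) r) →
    Call runsᶠ (tree ∷ encodeList encodePath Ps ∷ [])
      (encodeList (encodeList (encodePair encodeℕ)) (List.map (runOf bs) Ps)) (runsCost m r (length Ps))
  runs-run {m} {r = r} bs [] _ _ = loop-end 50 (boxCost m ℕ.+ (r ℕ.+ r)) 0 (case-nilᵉ varᵉ nilᵉ)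
  runs-run {m} {r = r} bs (P ∷ Ps) (≤m ∷ ≤ms) (inj₂ ranks) =
    loop-step 50 (boxCost m ∷ r ∷ r ∷ []) (runsCost m r (length Ps))
      (case-consᵉ varᵉ (consᵉ
        (case-consᵉ (callᵉ (varᵉ ∷ᵉ []ᵉ) (box P ≤m)) (case-consᵉ varᵉ
          (consᵉ (consᵉ
            (addᵉ litᵉ (callᵉ (varᵉ ∷ᵉ subᵉ varᵉ litᵉ ∷ᵉ []ᵉ) (ranks (bottom P ℤ.- + 1))))
            (callᵉ (varᵉ ∷ᵉ varᵉ ∷ᵉ []ᵉ) (ranks (top P)))) nilᵉ)))
        (callᵉ (varᵉ ∷ᵉ varᵉ ∷ᵉ []ᵉ) (runs-run bs Ps ≤ms (inj₂ ranks)))))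

  pathEdges : ℕ → ℕ → List (ℕ × ℕ)
  pathEdges i zero    = []
  pathEdges i (suc n) = (i , suc i) ∷ pathEdges (suc i) n

  edges-run : ∀ i (Ps : List GridPath) → Call edgesᶠ (encodeℕ i ∷ encodeList encodePath Ps ∷ [])
    (encodeList (encodePair encodeℕ) (pathEdges i (length Ps))) (edgesCost (length Ps))
  edges-run i []       = loop-end 20 0 0 (case-nilᵉ varᵉ nilᵉ)
  edges-run i (P ∷ Ps) = loop-step 20 [] (edgesCost (length Ps))
    (case-consᵉ varᵉ (consᵉ (consᵉ varᵉ (addᵉ litᵉ varᵉ))
      (callᵉ (addᵉ litᵉ varᵉ ∷ᵉ varᵉ ∷ᵉ []ᵉ) (edges-run (suc i) Ps))))

  length-run : ∀ Ps → Call lengthᶠ (encodeList encodePath Ps ∷ []) (encodeℕ (length Ps)) (lengthCost (length Ps))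
  length-run []       = loop-end 20 0 0 (case-nilᵉ varᵉ litᵉ)
  length-run (P ∷ Ps) = loop-step 20 [] (lengthCost (length Ps))
    (case-consᵉ varᵉ (addᵉ litᵉ (callᵉ (varᵉ ∷ᵉ []ᵉ) (length-run Ps))))

  level-run : ∀ x P i d {u₁ u₂ u₃ u₄} →
    Run (encodeℕ d ∷ encodePath P ∷ u₁ ∷ u₂ ∷ u₃ ∷ encodeMode x ∷ encodeℕ i ∷ u₄ ∷ [])
      levelBody (encodeℕ (level x (List⁺.tail (corners P)) i d)) 20
  level-run vpg P i d = loop-end 20 0 0 (if-yesᵉ ℤ.≤-refl varᵉ litᵉ varᵉ)
  level-run epg P i d with corners P
  ... | p ∷ []     = loop-end 20 0 0
        (if-noᵉ (ℤ.+<+ (s≤s z≤n)) varᵉ litᵉ (case-consᵉ varᵉ (case-nilᵉ varᵉ varᵉ)))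
  ... | p ∷ q ∷ ps = loop-end 20 0 0
        (if-noᵉ (ℤ.+<+ (s≤s z≤n)) varᵉ litᵉ (case-consᵉ varᵉ (case-consᵉ varᵉ varᵉ)))

  layersFrom : Mode → ℕ → ℤ → ℕ → List GridPath → List ℕ
  layersFrom x n xmin i []       = []
  layersFrom x n xmin i (P ∷ Ps) = layerIndex ℓ x n xmin i P ∷ layersFrom x n xmin (suc i) Ps

  layers-run : ∀ {m} x n xmin i Ps → All (Corners≤ m) Ps → All (λ P → xmin ℤ.≤ left P) Ps →
    Call layersᶠ (encodeℕ n ∷ int xmin ∷ encodeMode x ∷ encodeℕ i ∷ encodeList encodePath Ps ∷ [])
      (encodeList encodeℕ (layersFrom x n xmin i Ps)) (layersCost m (length Ps))
  layers-run {m} x n xmin i [] _ _ = loop-end 70 (boxCost m) 0 (case-nilᵉ varᵉ nilᵉ)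
  layers-run {m} x n xmin i (P ∷ Ps) (≤m ∷ ≤ms) (xmin≤ ∷ xmin≤s) = close
    (loop-step 50 (boxCost m ∷ 20 ∷ []) (layersCost m (length Ps))
      (case-consᵉ varᵉ (consᵉ
        (bindᵉ (case-consᵉ (callᵉ (varᵉ ∷ᵉ []ᵉ) (box P ≤m)) (addᵉ varᵉ (divᵉ (subᵉ varᵉ varᵉ))))
          -- The program divides the integer `left P - xmin`. It is nonnegative, so it may be
          -- replaced by its absolute value, on which integer division computes to the natural
          -- quotient.
          (subst
            (λ z → Run (int (+ n ℤ.+ z ℤ./ℕ ℓ) ∷ encodePath P ∷ encodeList encodePath Ps ∷ encodeℕ n ∷
                        int xmin ∷ encodeMode x ∷ encodeℕ i ∷ encodeList encodePath (P ∷ Ps) ∷ [])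
              levelBody (encodeℕ (layerIndex ℓ x n xmin i P)) 20)
            (nonneg⇒∣∣ xmin≤)
            (level-run x P i (n ℕ.+ ℤ.∣ left P ℤ.- xmin ∣ ℕ./ ℓ))))
        (callᵉ (varᵉ ∷ᵉ varᵉ ∷ᵉ varᵉ ∷ᵉ addᵉ litᵉ varᵉ ∷ᵉ varᵉ ∷ᵉ []ᵉ)
          (layers-run x n xmin (suc i) Ps ≤ms xmin≤s)))))
    (ℕ.≤-reflexive (cong (ℕ._+ layersCost m (length Ps))
      (solve 1 (λ b → con 50 :+ (b :+ con 20) := con 70 :+ b) refl (boxCost m))))
    where open +-*-Solver

  outputOf : Mode → ℤ → List GridPath → Val
  outputOf x xmin Ps =
    cons (encodeℕ (suc (length Ps)))
    (cons (encodeList (encodePair encodeℕ) (pathEdges 0 (length Ps)))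
    (cons (encodeList (encodeList (encodePair encodeℕ)) (List.map (runOf (List.map bottom Ps)) Ps))
          (encodeList encodeℕ (layersFrom x (length Ps) xmin 0 Ps))))

  main-run : ∀ {m} L x g Ps → length Ps ℕ.≤ 2 ℕ.^ L →
    All (Corners≤ m) Ps → All (λ P → Grid.xmin g ℤ.≤ left P) Ps →
    Run (cons (encodeGrid g) (cons (encodeList encodePath Ps) (encodeMode x)) ∷ []) mainBody
      (outputOf x (Grid.xmin g) Ps)
      (runningTime m L (length Ps))
  main-run {m} L x g Ps len≤ corners≤ xmin≤ with index-run L Ps len≤
  ... | sorted , tree , sorts , builds , ranks =
    loop-step 100 (stageCosts m L (length Ps)) (layersCost m (length Ps))
      (case-consᵉ varᵉ (case-consᵉ varᵉ (case-consᵉ varᵉ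
        (bindᵉ (callᵉ (varᵉ ∷ᵉ []ᵉ) (length-run Ps))
        (consᵉ (addᵉ litᵉ varᵉ)
        (consᵉ (callᵉ (litᵉ ∷ᵉ varᵉ ∷ᵉ []ᵉ) (edges-run 0 Ps))
        (consᵉ (callᵉ (callᵉ (litᵉ ∷ᵉ callᵉ (litᵉ ∷ᵉ callᵉ (varᵉ ∷ᵉ []ᵉ) (singles Ps corners≤) ∷ᵉ []ᵉ)
                        sorts ∷ᵉ []ᵉ) builds ∷ᵉ varᵉ ∷ᵉ []ᵉ)
                 (runs-run (List.map bottom Ps) Ps corners≤ ranks))
               (callᵉ (varᵉ ∷ᵉ varᵉ ∷ᵉ varᵉ ∷ᵉ litᵉ ∷ᵉ varᵉ ∷ᵉ []ᵉ)
                 (layers-run x (length Ps) (Grid.xmin g) 0 Ps corners≤ xmin≤)))))))))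

-- Asymptotics

n≤2^⌈log₂n⌉ : ∀ n → n ℕ.≤ 2 ℕ.^ ⌈log₂ n ⌉
n≤2^⌈log₂n⌉ = <-rec _ λ where
    0 _ → z≤n
    1 _ → ℕ.≤-refl
    n@(suc (suc n′)) rec → let h = ℕ.⌈ n /2⌉ in begin
      n                                          ≡⟨ ℕ.⌊n/2⌋+⌈n/2⌉≡n n ⟨
      ℕ.⌊ n /2⌋ ℕ.+ h                            ≤⟨ ℕ.+-monoˡ-≤ h (ℕ.⌊n/2⌋≤⌈n/2⌉ n) ⟩
      h ℕ.+ h                                    ≡⟨ cong (h ℕ.+_) (ℕ.+-identityʳ h) ⟨
      2 ℕ.* h                                    ≤⟨ ℕ.*-monoʳ-≤ 2 (rec (ℕ.⌈n/2⌉<n n′)) ⟩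
      2 ℕ.* 2 ℕ.^ ⌈log₂ h ⌉                      ≡⟨ cong (λ L → 2 ℕ.^ suc L) (⌈log₂⌈n/2⌉⌉≡⌈log₂n⌉∸1 n) ⟩
      2 ℕ.^ suc (⌈log₂ n ⌉ ∸ 1)                  ≡⟨ cong (2 ℕ.^_) (ℕ.m+[n∸m]≡n
                                                      (⌈log₂⌉-mono-≤ {2} {n} (s≤s (s≤s z≤n)))) ⟩
      2 ℕ.^ ⌈log₂ n ⌉                            ∎
  where open ℕ.≤-Reasoning

module _ (n L : ℕ) where

  private
    -- A product of successors dominates constants, linear terms and logarithmic terms at once, also
    -- when `n` or `L` is 0.
    x : ℕ
    x = suc n ℕ.* suc L

  +-scaled : ∀ {c d} K J → c ℕ.≤ x ℕ.* K → d ℕ.≤ x ℕ.* J → c ℕ.+ d ℕ.≤ x ℕ.* (K ℕ.+ J)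
  +-scaled K J c≤ d≤ = ℕ.≤-trans (ℕ.+-mono-≤ c≤ d≤) (ℕ.≤-reflexive (sym (ℕ.*-distribˡ-+ x K J)))

  total-scaled : ∀ {cs Ks} → Pointwise (λ c K → c ℕ.≤ x ℕ.* K) cs Ks → total cs ℕ.≤ x ℕ.* total Ks
  total-scaled []                                             = z≤n
  total-scaled (c≤ ∷ [])                                      = c≤
  total-scaled {_ ∷ _ ∷ _} {K ∷ J ∷ Ks} (c≤ ∷ cs≤@(_ ∷ _)) =
    +-scaled K (total (J ∷ Ks)) c≤ (total-scaled cs≤)

  linear≤ : ∀ K → suc n ℕ.* K ℕ.≤ x ℕ.* K
  linear≤ K = ℕ.*-monoˡ-≤ K (ℕ.m≤m*n (suc n) (suc L))

  reduceCost≤ : ∀ W → W ℕ.≤ n ℕ.* 2 → reduceCost L W ℕ.≤ x ℕ.* 190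
  reduceCost≤ W W≤ = begin
    suc L ℕ.* (30 ℕ.+ passCost W)            ≤⟨ ℕ.*-monoʳ-≤ (suc L) (ℕ.+-monoʳ-≤ 30 (ℕ.*-monoˡ-≤ 80 (s≤s W≤))) ⟩
    -- The added term is the exact slack from `110 + 160n` to `190(n + 1)`.
    suc L ℕ.* (30 ℕ.+ passCost (n ℕ.* 2))    ≤⟨ ℕ.m≤m+n _ (suc L ℕ.* (80 ℕ.+ 30 ℕ.* n)) ⟩
    suc L ℕ.* (30 ℕ.+ passCost (n ℕ.* 2)) ℕ.+ suc L ℕ.* (80 ℕ.+ 30 ℕ.* n)
      ≡⟨ solve 2 (λ n L → (con 1 :+ L) :* (con 30 :+ (con 1 :+ n :* con 2) :* con 80)
                          :+ (con 1 :+ L) :* (con 80 :+ con 30 :* n)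
                       := (con 1 :+ n) :* (con 1 :+ L) :* con 190) refl n L ⟩
    x ℕ.* 190                                ∎
    where
    open ℕ.≤-Reasoning
    open +-*-Solver

  runsCost≤ : ∀ m → runsCost m (rankCost L) n ℕ.≤ x ℕ.* (50 ℕ.+ (boxCost m ℕ.+ 80))
  runsCost≤ m = begin
    suc n ℕ.* (50 ℕ.+ (b ℕ.+ (rankCost L ℕ.+ rankCost L)))
      ≤⟨ ℕ.m≤m+n _ (suc n ℕ.* (L ℕ.* (50 ℕ.+ b))) ⟩
    suc n ℕ.* (50 ℕ.+ (b ℕ.+ (rankCost L ℕ.+ rankCost L))) ℕ.+ suc n ℕ.* (L ℕ.* (50 ℕ.+ b))
      ≡⟨ solve 3 (λ n L b →
           (con 1 :+ n) :* (con 50 :+ (b :+ ((con 1 :+ L) :* con 40 :+ (con 1 :+ L) :* con 40)))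
             :+ (con 1 :+ n) :* (L :* (con 50 :+ b))
        := (con 1 :+ n) :* (con 1 :+ L) :* (con 50 :+ (b :+ con 80))) refl n L b ⟩
    x ℕ.* (50 ℕ.+ (b ℕ.+ 80)) ∎
    where
    open ℕ.≤-Reasoning
    open +-*-Solver
    b = boxCost m

stageFactors : ℕ → List ℕ
stageFactors m = 20 ∷ 20 ∷ 40 ℕ.+ boxCost m ∷ 190 ∷ 190 ∷ 50 ℕ.+ (boxCost m ℕ.+ 80) ∷ []

timeFactor : ℕ → ℕ
timeFactor m = 100 ℕ.+ total (stageFactors m) ℕ.+ (70 ℕ.+ boxCost m)

runningTime≤ : ∀ m n L → runningTime m L n ℕ.≤ suc n ℕ.* suc L ℕ.* timeFactor m
runningTime≤ m n L = +-scaled n L (100 ℕ.+ total (stageFactors m)) (70 ℕ.+ boxCost m)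
  (+-scaled n L 100 (total (stageFactors m)) (ℕ.m≤n*m 100 (suc n ℕ.* suc L))
    (total-scaled n L {stageCosts m L n} {stageFactors m}
      (linear≤ n L 20 ∷ linear≤ n L 20 ∷ linear≤ n L (40 ℕ.+ boxCost m) ∷
       reduceCost≤ n L (n ℕ.* 2) ℕ.≤-refl ∷ reduceCost≤ n L n (ℕ.m≤m*n n 2) ∷ runsCost≤ n L m ∷ [])))
  (linear≤ n L (70 ℕ.+ boxCost m))

runningTime∈O : ∀ m → (λ n → runningTime m ⌈log₂ n ⌉ n) ∈O (λ n → n ℕ.* ⌈log₂ n ⌉)
-- From `n = 2` on, both `n` and its logarithm are at least 1, so each successor is at most a
-- double; this gives the factor 4. At `n = 1` the logarithm vanishes.
runningTime∈O m = 4 ℕ.* K , 2 , λ n n≥2 → let L = ⌈log₂ n ⌉ in begin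
  runningTime m L n                ≤⟨ runningTime≤ m n L ⟩
  suc n ℕ.* suc L ℕ.* K            ≤⟨ ℕ.*-monoˡ-≤ K (ℕ.*-mono-≤
                                        (suc≤double (ℕ.≤-trans (s≤s z≤n) n≥2))
                                        (suc≤double (⌈log₂⌉-mono-≤ {2} {n} n≥2))) ⟩
  2 ℕ.* n ℕ.* (2 ℕ.* L) ℕ.* K      ≡⟨ solve 3 (λ n L K → con 2 :* n :* (con 2 :* L) :* K
                                        := con 4 :* K :* (n :* L)) refl n L K ⟩
  4 ℕ.* K ℕ.* (n ℕ.* L)            ∎
  where
  open ℕ.≤-Reasoning
  open +-*-Solver
  K = timeFactor m
  suc≤double : ∀ {a} → 1 ℕ.≤ a → suc a ℕ.≤ 2 ℕ.* a
  suc≤double {a} 1≤a = ℕ.≤-trans (ℕ.+-monoˡ-≤ a 1≤a) (ℕ.≤-reflexive (cong (a ℕ.+_) (sym (ℕ.+-identityʳ a))))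

-- The output encodes the decomposition

encodeList-tabulate : ∀ {A B : Set} {f : A → Val} {g : B → Val} {n} {a : Fin n → A} {b : Fin n → B} →
  (∀ i → f (a i) ≡ g (b i)) → encodeList f (List.tabulate a) ≡ encodeList g (List.tabulate b)
encodeList-tabulate {n = zero}  eq = refl
encodeList-tabulate {n = suc n} eq = cong₂ cons (eq zero) (encodeList-tabulate (eq ∘ suc))

module Output {n} {G : Graph n} (R : GridRepresentation G) (ℓ : ℕ) (1≤ℓ : 1 ℕ.≤ ℓ)
  (short : ∀ u → horizontalLength (path R u) ℤ.≤ + ℓ) where

  open Decomposition R ℓ 1≤ℓ short
  open Correctness ℓ

  paths : List GridPath
  paths = List.tabulate (path R)

  bottoms≡ : List.map bottom paths ≡ bottoms
  bottoms≡ = List.map-tabulate (path R) bottom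

  treeEdges : List (Fin (suc n) × Fin (suc n))
  treeEdges = List.tabulate (λ i → inject₁ i , suc i)

  -- The start `i` and the edge map `e` are general because the recursion shifts both.
  pathEdges≡ : ∀ {m N} i (e : Fin m → Fin N × Fin N) →
    (∀ j → toℕ (proj₁ (e j)) ≡ i ℕ.+ toℕ j) → (∀ j → toℕ (proj₂ (e j)) ≡ suc (i ℕ.+ toℕ j)) →
    encodeList (encodePair encodeℕ) (pathEdges i m) ≡ encodeList (encodePair encodeFin) (List.tabulate e)
  pathEdges≡ {zero}  i e eq₁ eq₂ = refl
  pathEdges≡ {suc m} i e eq₁ eq₂ = cong₂ cons
    (cong₂ cons (cong encodeℕ (sym (trans (eq₁ zero) (ℕ.+-identityʳ i))))
                (cong encodeℕ (sym (trans (eq₂ zero) (cong suc (ℕ.+-identityʳ i))))))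
    (pathEdges≡ (suc i) (e ∘ suc) (λ j → trans (eq₁ (suc j)) (ℕ.+-suc i (toℕ j)))
                                  (λ j → trans (eq₂ (suc j)) (cong suc (ℕ.+-suc i (toℕ j)))))

  lo<1+n : ∀ v → lo v ℕ.< suc n
  lo<1+n v = s≤s (ℕ.≤-trans (lo≤hi v) (rank≤n _))

  hi<1+n : ∀ v → hi v ℕ.< suc n
  hi<1+n v = s≤s (rank≤n _)

  nodeRuns : Fin n → List (Fin (suc n) × Fin (suc n))
  nodeRuns v = (fromℕ< (lo<1+n v) , fromℕ< (hi<1+n v)) ∷ []

  nodeRuns≡ : ∀ v → encodeList (encodePair encodeℕ) (runOf bottoms (path R v))
                  ≡ encodeList (encodePair encodeFin) (nodeRuns v)
  nodeRuns≡ v = cong (λ p → cons p nil) (cong₂ cons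
    (cong encodeℕ (sym (Fin.toℕ-fromℕ< (lo<1+n v)))) (cong encodeℕ (sym (Fin.toℕ-fromℕ< (hi<1+n v)))))

  runs≡ : encodeList (encodeList (encodePair encodeℕ)) (List.map (runOf (List.map bottom paths)) paths)
        ≡ encodeList (encodeList (encodePair encodeFin)) (List.tabulate nodeRuns)
  runs≡ = trans (cong (λ bs → encodeList (encodeList (encodePair encodeℕ)) (List.map (runOf bs) paths)) bottoms≡)
    (trans (cong (encodeList (encodeList (encodePair encodeℕ))) (List.map-tabulate (path R) (runOf bottoms)))
      (encodeList-tabulate nodeRuns≡))

  layersFrom≡ : ∀ x N x₀ {m} i (Q : Fin m → GridPath) → layersFrom x N x₀ i (List.tabulate Q)
    ≡ List.tabulate (λ j → layerIndex ℓ x N x₀ (i ℕ.+ toℕ j) (Q j))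
  layersFrom≡ x N x₀ {zero}  i Q = refl
  layersFrom≡ x N x₀ {suc m} i Q = cong₂ _∷_
    (cong (λ i → layerIndex ℓ x N x₀ i (Q zero)) (sym (ℕ.+-identityʳ i)))
    (trans (layersFrom≡ x N x₀ (suc i) (Q ∘ suc))
      (List.tabulate-cong (λ j → cong (λ i → layerIndex ℓ x N x₀ i (Q (suc j))) (sym (ℕ.+-suc i (toℕ j))))))

  ∈-treeEdges : ∀ {s t} → toℕ t ≡ suc (toℕ s) → (s , t) ∈ₗ treeEdges
  ∈-treeEdges {s} {suc t} eq = subst (λ s → (s , suc t) ∈ₗ treeEdges)
    (Fin.toℕ-injective (trans (Fin.toℕ-inject₁ t) (ℕ.suc-injective eq))) (Membership.∈-tabulate⁺ t)

  treeEdges-∈ : ∀ {s t} → (s , t) ∈ₗ treeEdges → toℕ t ≡ suc (toℕ s)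
  treeEdges-∈ e∈ with Membership.∈-tabulate⁻ e∈
  ... | i , refl = cong suc (sym (Fin.toℕ-inject₁ i))

  output-encodes : Encodes (outputOf (mode R) xmin paths) decomposition layering
  output-encodes = record
    { edges  = treeEdges
    ; runs   = nodeRuns
    ; format = trans
        (cong (λ N → cons (encodeℕ (suc N)) (cons (encodeList (encodePair encodeℕ) (pathEdges 0 N))
           (cons (encodeList (encodeList (encodePair encodeℕ)) (List.map (runOf (List.map bottom paths)) paths))
                 (encodeList encodeℕ (layersFrom (mode R) N xmin 0 paths)))))
          (List.length-tabulate (path R)))
        (cong (cons (encodeℕ (suc n))) (cong₂ cons
          (pathEdges≡ 0 (λ i → inject₁ i , suc i) Fin.toℕ-inject₁ (λ _ → refl))
          (cong₂ cons runs≡ (cong (encodeList encodeℕ) (layersFrom≡ (mode R) n xmin 0 (path R))))))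
    ; edges⇔ = λ s t → mk⇔ (Sum.map ∈-treeEdges ∈-treeEdges) (Sum.map treeEdges-∈ treeEdges-∈)
    ; runs⇔  = λ v t → mk⇔
        (λ v∈ → let lo≤ , ≤hi = ∈-tabulate⁻ (inRun? G n lo hi t) v∈ in
          here ( ℕ.≤-trans (ℕ.≤-reflexive (Fin.toℕ-fromℕ< (lo<1+n v))) lo≤
               , ℕ.≤-trans ≤hi (ℕ.≤-reflexive (sym (Fin.toℕ-fromℕ< (hi<1+n v))))))
        (λ { (here (lo≤ , ≤hi)) → ∈-tabulate⁺ (inRun? G n lo hi t)
          ( ℕ.≤-trans (ℕ.≤-reflexive (sym (Fin.toℕ-fromℕ< (lo<1+n v)))) lo≤
          , ℕ.≤-trans ≤hi (ℕ.≤-reflexive (Fin.toℕ-fromℕ< (hi<1+n v)))) })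
    }

  module _ (k : ℕ) (few-bends : ∀ u → bends (path R u) ℕ.≤ k) where

    corners≤ : All (Corners≤ (2 ℕ.+ k)) paths
    corners≤ = All.tabulate⁺ λ u →
      -- `bends` truncates at 0, so single-point paths also obey the bound of `2 + k` corners.
      ℕ.≤-trans (ℕ.m≤n+m∸n _ 2) (ℕ.+-monoʳ-≤ 2 (few-bends u))

    open Evaluation (program ℓ)

    computation : Run (encodeRepresentation R ∷ []) mainBody (outputOf (mode R) xmin paths)
      (runningTime (2 ℕ.+ k) ⌈log₂ n ⌉ n)
    computation = subst
      (λ N → Run (encodeRepresentation R ∷ []) mainBody (outputOf (mode R) xmin paths)
        (runningTime (2 ℕ.+ k) ⌈log₂ n ⌉ N))
      (List.length-tabulate (path R))
      (main-run ⌈log₂ n ⌉ (mode R) (grid R) paths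
        (ℕ.≤-trans (ℕ.≤-reflexive (List.length-tabulate (path R))) (n≤2^⌈log₂n⌉ n))
        corners≤ (All.tabulate⁺ xmin≤left))

theorem4p13 : (ℓ k : ℕ) → 1 ≤ ℓ →
    Σ Program λ P → ∃₂ λ (time size : ℕ → ℕ) →
    time ∈O (λ n → n * ⌈log₂ n ⌉) ×
    size ∈O (λ n → n) ×
    ((n : ℕ) (G : Graph n) (R : GridRepresentation G) →
    ((u : Fin n) → horizontalLength (path R u) ℤ.≤ + ℓ) →
    ((u : Fin n) → bends (path R u) ≤ k) →
    (∃₂ λ (𝒯 : TreeDecomposition G) (L : Layering G) →
    ∃₂ λ (output : Val) (cost : ℕ) →
    Runs P (encodeRepresentation R) output cost ×
    cost ≤ time n ×
    Encodes output 𝒯 L ×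
    nodes 𝒯 ≤ size n ×
    (∀ t i → α G (bag 𝒯 t ∩ layer L i) ≤ bound (mode R) ℓ)) ×
    LayeredTreeIndependenceNumber≤ G (bound (mode R) ℓ))
theorem4p13 ℓ k 1≤ℓ =
  program ℓ {{ℕ.>-nonZero 1≤ℓ}} , (λ n → runningTime (2 ℕ.+ k) ⌈log₂ n ⌉ n) , suc
  , runningTime∈O (2 ℕ.+ k)
  , (2 , 1 , λ n 1≤n → ℕ.≤-trans (ℕ.+-monoˡ-≤ n 1≤n)
      (ℕ.≤-reflexive (cong (n ℕ.+_) (sym (ℕ.+-identityʳ n)))))
  , λ n G R short few-bends →
      let open Decomposition R ℓ 1≤ℓ short
          open Output R ℓ 1≤ℓ short
          evaluation = computation k few-bends
      in ( decomposition , layering , _ , _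
         , Evaluation.Eval.run evaluation , Evaluation.Eval.within evaluation
         , output-encodes , ℕ.≤-refl , α-bag-layer≤bound)
       , width-bound decomposition layering α-bag-layer≤bound
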